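{- Let $m\ge 3$ be an integer, let $p_1,p_2,\dots,p_m\in\mathbb{C}[x]$ be nonzero polynomials and let $k_1,k_2,\dots,k_m$ be positive integers. Suppose that $$\gcd\left(p_1^{k_1},p_2^{k_2},\dots,p_m^{k_m}\right)=1,\qquad p_1^{k_1}+p_2^{k_2}+\dots+p_m^{k_m}=0,$$ and that any $m-1$ of the $m$ polynomials $p_1^{k_1},\dots,p_m^{k_m}$ are linearly independent over $\mathbb{C}$ (that is, for every index $j\in\{1,\dots,m\}$ the family $(p_i^{k_i})_{i\ne j}$ is linearly independent). Then $$\min\{k_1,k_2,\dots,k_m\}<\frac{1}{3}\left(m^3+7m^2-49m+68\right).$$
   Context: The gcd condition means that the $m$ polynomials have no common nonconstant divisor in $\mathbb{C}[x]$ (they are not required to be pairwise coprime). -}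

module Defs where

open import Algebra.Bundles.Raw using (RawRing; RawSemiring)
import Algebra.Definitions.RawSemiring as SemiringDefs
open import Data.List.Base using (List; []; _∷_; map)
open import Data.Nat.Base as ℕ using (ℕ; zero; suc)
import Data.Nat.Properties as ℕ
open import Data.Product.Base using (∃; _,_; _×_)
open import Data.Rational.Base hiding (_⊔_)
open import Data.Rational.Properties
open import Data.Rational.Solver using (module +-*-Solver)
open import Data.Vec.Functional as Vector using (Vector)
open import Level using (Level; 0ℓ; _⊔_)
open import Relation.Binary.PropositionalEquality
  using (_≡_; refl; sym; cong; subst)

-- Real numbers as Cauchy sequences of rationals; the quotient by null
-- sequences is replaced by the setoid equality _≈ℝ_.

IsCauchy : (ℕ → ℚ) → Set
IsCauchy x = ∀ ε → 0ℚ < ε →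
  ∃ λ N → ∀ m n → N ℕ.≤ m → N ℕ.≤ n → ∣ x m - x n ∣ < ε

record ℝ : Set where
  constructor mkℝ
  field
    seq    : ℕ → ℚ
    cauchy : IsCauchy seq

open ℝ public

infix 4 _≈ℝ_

_≈ℝ_ : ℝ → ℝ → Set
x ≈ℝ y = ∀ ε → 0ℚ < ε →
  ∃ λ N → ∀ n → N ℕ.≤ n → ∣ seq x n - seq y n ∣ < ε

fromℚ : ℚ → ℝ
fromℚ q = mkℝ (λ _ → q) λ ε 0<ε → 0 , λ _ _ _ _ →
  subst (_< ε) (sym (cong ∣_∣ (+-inverseʳ q))) 0<ε

private abstract
  half-pos : ∀ ε → 0ℚ < ε → 0ℚ < ½ * ε
  half-pos ε 0<ε = subst (_< ½ * ε) (*-zeroʳ ½) (*-monoʳ-<-pos ½ 0<ε)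

  halves : ∀ ε → ½ * ε + ½ * ε ≡ ε
  halves = solve 1 (λ e → con ½ :* e :+ con ½ :* e := e) refl
    where open +-*-Solver

  +-diff : ∀ a b c d → (a + b) - (c + d) ≡ (a - c) + (b - d)
  +-diff = solve 4 (λ a b c d →
    (a :+ b) :- (c :+ d) := (a :- c) :+ (b :- d)) refl
    where open +-*-Solver

  *-diff : ∀ a b c d → a * b - c * d ≡ a * (b - d) + (a - c) * d
  *-diff = solve 4 (λ a b c d →
    a :* b :- c :* d := a :* (b :- d) :+ (a :- c) :* d) refl
    where open +-*-Solver

  neg-diff : ∀ a c → (- a) - (- c) ≡ - (a - c)
  neg-diff = solve 2 (λ a c → (:- a) :- (:- c) := :- (a :- c)) refl
    where open +-*-Solver

  split : ∀ a b → a ≡ (a - b) + b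
  split = solve 2 (λ a b → a := (a :- b) :+ b) refl
    where open +-*-Solver

  +-cauchy : ∀ x y → IsCauchy x → IsCauchy y → IsCauchy (λ n → x n + y n)
  +-cauchy x y cx cy ε 0<ε
    with M , hx ← cx (½ * ε) (half-pos ε 0<ε)
       | N , hy ← cy (½ * ε) (half-pos ε 0<ε)
    = M ℕ.⊔ N , λ m n le-m le-n → begin-strict
        ∣ (x m + y m) - (x n + y n) ∣   ≡⟨ cong ∣_∣ (+-diff (x m) (y m) (x n) (y n)) ⟩
        ∣ (x m - x n) + (y m - y n) ∣   ≤⟨ ∣p+q∣≤∣p∣+∣q∣ (x m - x n) (y m - y n) ⟩
        ∣ x m - x n ∣ + ∣ y m - y n ∣   <⟨ +-mono-<
          (hx m n (ℕ.m⊔n≤o⇒m≤o M N le-m) (ℕ.m⊔n≤o⇒m≤o M N le-n))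
          (hy m n (ℕ.m⊔n≤o⇒n≤o M N le-m) (ℕ.m⊔n≤o⇒n≤o M N le-n)) ⟩
        ½ * ε + ½ * ε                   ≡⟨ halves ε ⟩
        ε                               ∎
    where open ≤-Reasoning

  neg-cauchy : ∀ x → IsCauchy x → IsCauchy (λ n → - x n)
  neg-cauchy x cx ε 0<ε with N , hx ← cx ε 0<ε
    = N , λ m n le-m le-n → begin-strict
        ∣ (- x m) - (- x n) ∣   ≡⟨ cong ∣_∣ (neg-diff (x m) (x n)) ⟩
        ∣ - (x m - x n) ∣       ≡⟨ ∣-p∣≡∣p∣ (x m - x n) ⟩
        ∣ x m - x n ∣           <⟨ hx m n le-m le-n ⟩
        ε                       ∎
    where open ≤-Reasoning

  0<1 : 0ℚ < 1ℚ
  0<1 = positive⁻¹ 1ℚ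

  eventually-bounded : ∀ x → IsCauchy x →
    ∃ λ B → 0ℚ < B × ∃ λ N → ∀ n → N ℕ.≤ n → ∣ x n ∣ ≤ B
  eventually-bounded x cx with N , hx ← cx 1ℚ 0<1
    = 1ℚ + ∣ x N ∣ , +-mono-<-≤ 0<1 (0≤∣p∣ (x N)) , N , λ n le → begin
        ∣ x n ∣                   ≡⟨ cong ∣_∣ (split (x n) (x N)) ⟩
        ∣ (x n - x N) + x N ∣     ≤⟨ ∣p+q∣≤∣p∣+∣q∣ (x n - x N) (x N) ⟩
        ∣ x n - x N ∣ + ∣ x N ∣   ≤⟨ +-monoˡ-≤ ∣ x N ∣ (<⇒≤ (hx n N le ℕ.≤-refl)) ⟩
        1ℚ + ∣ x N ∣              ∎
    where open ≤-Reasoning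

  *-bound : ∀ p q B δ → 0ℚ < B → ∣ p ∣ ≤ B → ∣ q ∣ < δ → ∣ p * q ∣ < B * δ
  *-bound p q B δ 0<B p≤B q<δ = begin-strict
      ∣ p * q ∣       ≡⟨ ∣p*q∣≡∣p∣*∣q∣ p q ⟩
      ∣ p ∣ * ∣ q ∣   ≤⟨ *-monoʳ-≤-nonNeg ∣ q ∣ {{∣-∣-nonNeg q}} p≤B ⟩
      B * ∣ q ∣       <⟨ *-monoʳ-<-pos B {{positive 0<B}} q<δ ⟩
      B * δ           ∎
    where open ≤-Reasoning

  scale : ∀ B → 0ℚ < B → ∀ ε → 0ℚ < ε → ∃ λ δ → 0ℚ < δ × B * δ ≡ ε
  scale B 0<B ε 0<ε = 1/ B * ε , 0<δ , eq
    where
    instance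
      B-pos : Positive B
      B-pos = positive 0<B
      B-nonZero : NonZero B
      B-nonZero = pos⇒nonZero B
      1/B-pos : Positive (1/ B)
      1/B-pos = 1/pos⇒pos B
    0<δ : 0ℚ < 1/ B * ε
    0<δ = subst (_< 1/ B * ε) (*-zeroʳ (1/ B)) (*-monoʳ-<-pos (1/ B) 0<ε)
    eq : B * (1/ B * ε) ≡ ε
    eq = begin-equality
        B * (1/ B * ε)   ≡⟨ *-assoc B (1/ B) ε ⟨
        B * 1/ B * ε     ≡⟨ cong (_* ε) (*-inverseʳ B) ⟩
        1ℚ * ε           ≡⟨ *-identityˡ ε ⟩
        ε                ∎
      where open ≤-Reasoning

  *-close : ∀ a b c d {A B δ} → 0ℚ < A → 0ℚ < B → ∣ a ∣ ≤ A → ∣ d ∣ ≤ B →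
    ∣ a - c ∣ < δ → ∣ b - d ∣ < δ → ∣ a * b - c * d ∣ < (A + B) * δ
  *-close a b c d {A} {B} {δ} 0<A 0<B a≤A d≤B ac bd = begin-strict
      ∣ a * b - c * d ∣                       ≡⟨ cong ∣_∣ (*-diff a b c d) ⟩
      ∣ a * (b - d) + (a - c) * d ∣           ≤⟨ ∣p+q∣≤∣p∣+∣q∣ (a * (b - d)) ((a - c) * d) ⟩
      ∣ a * (b - d) ∣ + ∣ (a - c) * d ∣       ≡⟨ cong (λ z → ∣ a * (b - d) ∣ + ∣ z ∣) (*-comm (a - c) d) ⟩
      ∣ a * (b - d) ∣ + ∣ d * (a - c) ∣       <⟨ +-mono-< (*-bound a (b - d) A δ 0<A a≤A bd)
                                                          (*-bound d (a - c) B δ 0<B d≤B ac) ⟩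
      A * δ + B * δ                           ≡⟨ *-distribʳ-+ δ A B ⟨
      (A + B) * δ                             ∎
    where open ≤-Reasoning

  *-cauchy : ∀ x y → IsCauchy x → IsCauchy y → IsCauchy (λ n → x n * y n)
  *-cauchy x y cx cy ε 0<ε =
    let A , 0<A , K , bx = eventually-bounded x cx
        B , 0<B , L , by = eventually-bounded y cy
        δ , 0<δ , eq = scale (A + B) (+-mono-< 0<A 0<B) ε 0<ε
        M , hx = cx δ 0<δ
        N , hy = cy δ 0<δ
    in (K ℕ.⊔ L) ℕ.⊔ (M ℕ.⊔ N) , λ m n le-m le-n →
        let KL≤m = ℕ.m⊔n≤o⇒m≤o (K ℕ.⊔ L) (M ℕ.⊔ N) le-m
            KL≤n = ℕ.m⊔n≤o⇒m≤o (K ℕ.⊔ L) (M ℕ.⊔ N) le-n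
            MN≤m = ℕ.m⊔n≤o⇒n≤o (K ℕ.⊔ L) (M ℕ.⊔ N) le-m
            MN≤n = ℕ.m⊔n≤o⇒n≤o (K ℕ.⊔ L) (M ℕ.⊔ N) le-n
        in subst (∣ x m * y m - x n * y n ∣ <_) eq
             (*-close (x m) (y m) (x n) (y n) {A} {B} {δ} 0<A 0<B
               (bx m (ℕ.m⊔n≤o⇒m≤o K L KL≤m))
               (by n (ℕ.m⊔n≤o⇒n≤o K L KL≤n))
               (hx m n (ℕ.m⊔n≤o⇒m≤o M N MN≤m) (ℕ.m⊔n≤o⇒m≤o M N MN≤n))
               (hy m n (ℕ.m⊔n≤o⇒n≤o M N MN≤m) (ℕ.m⊔n≤o⇒n≤o M N MN≤n)))

infixl 6 _+ℝ_ _-ℝ_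
infixl 7 _*ℝ_
infix  8 -ℝ_

_+ℝ_ : ℝ → ℝ → ℝ
x +ℝ y = mkℝ (λ n → seq x n + seq y n) (+-cauchy (seq x) (seq y) (cauchy x) (cauchy y))

_*ℝ_ : ℝ → ℝ → ℝ
x *ℝ y = mkℝ (λ n → seq x n * seq y n) (*-cauchy (seq x) (seq y) (cauchy x) (cauchy y))

-ℝ_ : ℝ → ℝ
-ℝ x = mkℝ (λ n → - seq x n) (neg-cauchy (seq x) (cauchy x))

_-ℝ_ : ℝ → ℝ → ℝ
x -ℝ y = x +ℝ (-ℝ y)

record ℂ : Set where
  constructor _+i_
  field
    re im : ℝ

open ℂ public

ℂ-rawRing : RawRing 0ℓ 0ℓ
ℂ-rawRing = record
  { Carrier = ℂ
  ; _≈_     = λ z w → re z ≈ℝ re w × im z ≈ℝ im w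
  ; _+_     = λ z w → (re z +ℝ re w) +i (im z +ℝ im w)
  ; _*_     = λ z w → (re z *ℝ re w -ℝ im z *ℝ im w)
                   +i (re z *ℝ im w +ℝ im z *ℝ re w)
  ; -_      = λ z → (-ℝ re z) +i (-ℝ im z)
  ; 0#      = fromℚ 0ℚ +i fromℚ 0ℚ
  ; 1#      = fromℚ 1ℚ +i fromℚ 0ℚ
  }

module Polynomials {c ℓ : Level} (R : RawRing c ℓ) where

  private module R = RawRing R

  -- Coefficient lists, constant term first.  Trailing zeros are allowed,
  -- so equality is coefficientwise.
  Poly : Set c
  Poly = List R.Carrier

  coeff : Poly → ℕ → R.Carrier
  coeff []      _       = R.0#
  coeff (a ∷ p) zero    = a
  coeff (a ∷ p) (suc n) = coeff p n

  infix 4 _≋_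
  _≋_ : Poly → Poly → Set ℓ
  p ≋ q = ∀ n → coeff p n R.≈ coeff q n

  infixl 6 _⊕_
  _⊕_ : Poly → Poly → Poly
  []      ⊕ q       = q
  (a ∷ p) ⊕ []      = a ∷ p
  (a ∷ p) ⊕ (b ∷ q) = (a R.+ b) ∷ (p ⊕ q)

  infixr 7 _·_
  _·_ : R.Carrier → Poly → Poly
  a · p = map (a R.*_) p

  infixl 7 _⊛_
  _⊛_ : Poly → Poly → Poly
  []      ⊛ q = []
  (a ∷ p) ⊛ q = (a · q) ⊕ (R.0# ∷ (p ⊛ q))

  poly-rawSemiring : RawSemiring c ℓ
  poly-rawSemiring = record
    { Carrier = Poly
    ; _≈_     = _≋_
    ; _+_     = _⊕_
    ; _*_     = _⊛_
    ; 0#      = []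
    ; 1#      = R.1# ∷ []
    }

  open RawSemiring poly-rawSemiring public using (0#; 1#; _≈_; _≉_)
  open SemiringDefs poly-rawSemiring public using (_^_; _∣_; sum)

  IsConstant : Poly → Set ℓ
  IsConstant p = ∀ n → coeff p (suc n) R.≈ R.0#

  -- gcd (v₁ , … , vₙ) = 1: jointly, not pairwise, coprime.
  JointlyCoprime : ∀ {n} → Vector Poly n → Set (c ⊔ ℓ)
  JointlyCoprime v = ∀ d → (∀ i → d ∣ v i) → IsConstant d

  LinearlyIndependent : ∀ {n} → Vector Poly n → Set (c ⊔ ℓ)
  LinearlyIndependent {n} v = (a : Vector R.Carrier n) →
    sum (λ i → a i · v i) ≈ 0# → ∀ i → a i R.≈ R.0#

module ℂ[x] = Polynomials ℂ-rawRing

minimum : ∀ {n} → Vector ℕ (suc n) → ℕ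
minimum k = Vector.foldr ℕ._⊓_ (Vector.head k) (Vector.tail k)

{-# OPTIONS --safe #-}
module Submission where

-- Put fᵢ = pᵢ^kᵢ, dᵢ = deg pᵢ, r = m − 2, and suppose kᵢ > m r for all i.
-- Fix j.  As in the proof of Mason's theorem, take a Wronskian W of the m − 1
-- independent polynomials fᵢ, i ≠ j, but with rows φ₀ = id and
-- φₗ₊₁ = (x d/dx − eₗ) φₗ, where e₀ > e₁ > ⋯ are the degrees of an echelon
-- basis of their span: in that basis the top coefficients form a triangular
-- matrix, so W ≠ 0.  Each φₗ fᵢ is divisible by qᵢ = pᵢ^(kᵢ − r), and φₗ does
-- not raise degrees.  Since Σ fᵢ = 0, omitting another index only changes the
-- sign of W, so Q = ∏ qᵢ divides qᵢ W for every i; as the qᵢ are jointly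
-- coprime, Q divides W.  Comparing degrees, Σᵢ (kᵢ − r) dᵢ ≤ Σ_{i≠j} kᵢ dᵢ, that
-- is, kⱼ dⱼ ≤ r Σ dᵢ.  Summing over j forces all dᵢ = 0, against independence.
-- Hence min kᵢ ≤ m (m − 2), which is below the cubic bound.
--
-- Equality in ℂ is undecidable, so case distinctions are made under double
-- negation; this is harmless because the conclusion is decidable.

open import Defs
open import Data.Nat.Base as ℕ using (ℕ; suc)
open import Data.Integer.Base as ℤ using (+_)
open import Data.Rational.Base as ℚ using (_/_)
open import Data.Fin.Base using (Fin)
open import Data.Vec.Functional using (Vector; removeAt)

open import Algebra.Bundles using (CommutativeMonoid; CommutativeRing)
open import Algebra.Bundles.Raw using (RawRing)
import Algebra.Consequences.Setoid as Consequences
import Algebra.Properties.CommutativeMonoid.Sum as MonoidSum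
import Algebra.Properties.CommutativeSemigroup as CommutativeSemigroupProperties
import Algebra.Properties.CommutativeSemigroup.Divisibility as CommutativeSemigroupDivisibility
import Algebra.Properties.Monoid.Mult as Mult
import Algebra.Properties.Ring as RingProperties
import Algebra.Properties.Semiring.Divisibility as SemiringDivisibility
import Algebra.Properties.Semiring.Sum as SemiringSum
open import Data.Fin.Base using (zero; suc; punchIn)
open import Data.Integer.Base using (ℤ)
import Data.Integer.Properties as ℤ
import Data.Integer.Solver as ℤSolver
open import Data.List.Base using ([]; _∷_; length; map)
open import Data.Nat.Base using (zero)
import Data.Nat.Properties as ℕ
open import Data.Product.Base using (∃; ∃₂; _×_; _,_; proj₁; proj₂)
open import Data.Rational.Base using (ℚ; 0ℚ; 1ℚ)
import Data.Rational.Properties as ℚ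
open import Data.Rational.Solver using (module +-*-Solver)
import Data.Rational.Unnormalised.Base as ℚᵘ
import Data.Rational.Unnormalised.Properties as ℚᵘ
open import Data.Sum.Base using (_⊎_; inj₁; inj₂; [_,_])
open import Data.Unit.Base using (⊤)
open import Data.Vec.Base as Vec using (Vec; []; _∷_; lookup; insertAt; tabulate)
import Data.Vec.Functional as Vector
import Data.Vec.Properties as Vec
open import Data.Vec.Relation.Binary.Pointwise.Inductive as Pointwise using (Pointwise; []; _∷_)
open import Data.Vec.Relation.Unary.All as All using (All; []; _∷_)
open import Function.Base using (_∘_; id)
open import Level using (Lift; 0ℓ; _⊔_)
open import Relation.Binary.Bundles using (Setoid)
open import Relation.Binary.PropositionalEquality as ≡ using (_≡_; _≢_)
import Relation.Binary.Reasoning.Setoid as SetoidReasoning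
open import Relation.Nullary.Decidable.Core using (Dec; yes; no; decidable-stable; ¬¬-excluded-middle)
open import Relation.Nullary.Negation.Core using (¬_; contradiction)

-- With ordinary derivatives, the non-vanishing of a Wronskian of independent polynomials would need
-- an argument of its own. Here every row operator multiplies the coefficient of x^n by a scalar.
-- The scalar in row l is the product of n - e over the l largest echelon degrees e: it vanishes at
-- those degrees and at no n below all of them, so the top coefficient of W can be read off. The
-- price is that rows do not lower degrees, which merely turns min kᵢ < m (m - 2) into min kᵢ ≤ m (m
-- - 2).
--
-- The rows have order 0 to m - 2, which is why each power pᵢ^kᵢ gives up at most r = m - 2 factors.
--
-- The qᵢ need not be pairwise coprime, so Q ∣ W cannot be assembled factor by factor. It comes
-- instead from a nonzero constant in the ideal of the qᵢ, found by Euclid's algorithm; neither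
-- irreducible factors nor roots of polynomials appear.
--
-- The degree bound on W and its divisibility are two instances of one induction over determinants.

-- Cauchy products of sequences

module Convolution {c ℓ} (R : CommutativeRing c ℓ) where

  open CommutativeRing R
  open SetoidReasoning setoid
  open CommutativeSemigroupProperties +-commutativeSemigroup using (interchange)
  open CommutativeSemigroupProperties *-commutativeSemigroup using (x∙yz≈y∙xz)

  infix 4 _≐_
  _≐_ : (f g : ℕ → Carrier) → Set ℓ
  f ≐ g = ∀ n → f n ≈ g n

  -- The recursion follows that of `_⊛_`, but on sequences no case distinction on lengths arises;
  -- the ring laws of polynomials are proved here and pulled back along `coeff`.
  conv : (f g : ℕ → Carrier) → ℕ → Carrier
  conv f g zero    = f 0 * g 0
  conv f g (suc n) = f 0 * g (suc n) + conv (f ∘ suc) g n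

  conv-cong : ∀ {f f′ g g′} → f ≐ f′ → g ≐ g′ → conv f g ≐ conv f′ g′
  conv-cong p q zero    = *-cong (p 0) (q 0)
  conv-cong p q (suc n) = +-cong (*-cong (p 0) (q (suc n))) (conv-cong (p ∘ suc) q n)

  -- The mirror image of the defining recursion, which turns commutativity into an induction.
  conv-sucʳ : ∀ f g n → conv f g (suc n) ≈ conv f (g ∘ suc) n + f (suc n) * g 0
  conv-sucʳ f g zero    = refl
  conv-sucʳ f g (suc n) = begin
    f 0 * g (2 ℕ.+ n) + conv (f ∘ suc) g (suc n)
      ≈⟨ +-congˡ (conv-sucʳ (f ∘ suc) g n) ⟩
    f 0 * g (2 ℕ.+ n) + (conv (f ∘ suc) (g ∘ suc) n + f (2 ℕ.+ n) * g 0)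
      ≈⟨ +-assoc _ _ _ ⟨
    conv f (g ∘ suc) (suc n) + f (2 ℕ.+ n) * g 0 ∎

  conv-comm : ∀ f g → conv f g ≐ conv g f
  conv-comm f g zero    = *-comm _ _
  conv-comm f g (suc n) = begin
    f 0 * g (suc n) + conv (f ∘ suc) g n   ≈⟨ +-cong (*-comm _ _) (conv-comm (f ∘ suc) g n) ⟩
    g (suc n) * f 0 + conv g (f ∘ suc) n   ≈⟨ +-comm _ _ ⟩
    conv g (f ∘ suc) n + g (suc n) * f 0   ≈⟨ conv-sucʳ g f n ⟨
    conv g f (suc n)                       ∎

  conv-distribʳ : ∀ f g h → conv (λ i → f i + g i) h ≐ (λ n → conv f h n + conv g h n)
  conv-distribʳ f g h zero    = distribʳ _ _ _
  conv-distribʳ f g h (suc n) =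
    trans (+-cong (distribʳ _ _ _) (conv-distribʳ (f ∘ suc) (g ∘ suc) h n)) (interchange _ _ _ _)

  conv-scaleˡ : ∀ a f g → conv (λ i → a * f i) g ≐ (λ n → a * conv f g n)
  conv-scaleˡ a f g zero    = *-assoc _ _ _
  conv-scaleˡ a f g (suc n) =
    trans (+-cong (*-assoc _ _ _) (conv-scaleˡ a (f ∘ suc) g n)) (sym (distribˡ _ _ _))

  conv-zeroˡ : ∀ {f} g → (∀ n → f n ≈ 0#) → ∀ n → conv f g n ≈ 0#
  conv-zeroˡ g f≈0 zero    = trans (*-congʳ (f≈0 0)) (zeroˡ _)
  conv-zeroˡ g f≈0 (suc n) =
    trans (+-cong (trans (*-congʳ (f≈0 0)) (zeroˡ _)) (conv-zeroˡ g (f≈0 ∘ suc) n)) (+-identityˡ _)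

  conv-constˡ : ∀ {f} g → (∀ n → f (suc n) ≈ 0#) → ∀ n → conv f g n ≈ f 0 * g n
  conv-constˡ g f≈0 zero    = refl
  conv-constˡ g f≈0 (suc n) = trans (+-congˡ (conv-zeroˡ g f≈0 n)) (+-identityʳ _)

  conv-assoc : ∀ f g h → conv (conv f g) h ≐ conv f (conv g h)
  conv-assoc f g h zero    = *-assoc _ _ _
  conv-assoc f g h (suc n) = begin
    f 0 * g 0 * h (suc n) + conv (λ i → f 0 * g (suc i) + conv (f ∘ suc) g i) h n
      ≈⟨ +-cong (*-assoc _ _ _) (trans (conv-distribʳ (λ i → f 0 * g (suc i)) (conv (f ∘ suc) g) h n)
           (+-cong (conv-scaleˡ (f 0) (g ∘ suc) h n) (conv-assoc (f ∘ suc) g h n))) ⟩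
    f 0 * (g 0 * h (suc n)) + (f 0 * conv (g ∘ suc) h n + conv (f ∘ suc) (conv g h) n)
      ≈⟨ +-assoc _ _ _ ⟨
    f 0 * (g 0 * h (suc n)) + f 0 * conv (g ∘ suc) h n + conv (f ∘ suc) (conv g h) n
      ≈⟨ +-congʳ (distribˡ _ _ _) ⟨
    f 0 * conv g h (suc n) + conv (f ∘ suc) (conv g h) n ∎

  conv-vanish : ∀ f g n → (∀ i j → i ℕ.+ j ≡ n → f i * g j ≈ 0#) → conv f g n ≈ 0#
  conv-vanish f g zero    z = z 0 0 ≡.refl
  conv-vanish f g (suc n) z = trans
    (+-cong (z 0 (suc n) ≡.refl) (conv-vanish (f ∘ suc) g n λ i j i+j≡n → z (suc i) j (≡.cong suc i+j≡n)))
    (+-identityˡ _)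

  conv-top : ∀ f g d e → (∀ n → d ℕ.< n → f n ≈ 0#) → (∀ n → e ℕ.< n → g n ≈ 0#) →
    conv f g (d ℕ.+ e) ≈ f d * g e
  conv-top f g zero    e f≈0 g≈0 = conv-constˡ g (λ n → f≈0 (suc n) (ℕ.s≤s ℕ.z≤n)) e
  conv-top f g (suc d) e f≈0 g≈0 = begin
    f 0 * g (suc (d ℕ.+ e)) + conv (f ∘ suc) g (d ℕ.+ e)
      ≈⟨ +-cong (trans (*-congˡ (g≈0 _ (ℕ.s≤s (ℕ.m≤n+m e d)))) (zeroʳ _))
                (conv-top (f ∘ suc) g d e (λ n d<n → f≈0 (suc n) (ℕ.s≤s d<n)) g≈0) ⟩
    0# + f (suc d) * g e  ≈⟨ +-identityˡ _ ⟩
    f (suc d) * g e       ∎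

  -- In the term f i * g j of index n = i + j the weight γ n splits as α i + β j. For α i = i, β j =
  -- j - e and γ n = n - e this is the product rule for x d/dx - e.
  conv-leibniz : ∀ (α β γ : ℕ → Carrier) → (∀ i j → γ (i ℕ.+ j) ≈ α i + β j) → ∀ f g n →
    γ n * conv f g n ≈ conv (λ i → α i * f i) g n + conv f (λ j → β j * g j) n
  conv-leibniz α β γ γ≈ f g = λ where
      zero    → term (γ≈ 0 0)
      (suc n) → trans (distribˡ _ _ _) (trans
        (+-cong (term (γ≈ 0 (suc n))) (conv-leibniz (α ∘ suc) β (γ ∘ suc) (γ≈ ∘ suc) (f ∘ suc) g n))
        (interchange _ _ _ _))
    where
    term : ∀ {a b s x y} → s ≈ a + b → s * (x * y) ≈ (a * x) * y + x * (b * y)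
    term eq = trans (*-congʳ eq) (trans (distribʳ _ _ _)
      (+-cong (sym (*-assoc _ _ _)) (x∙yz≈y∙xz _ _ _)))

-- The commutative ring of polynomials

module PolynomialRing {c ℓ} (R : CommutativeRing c ℓ) where

  private module R = CommutativeRing R
  open Convolution R public
  open Polynomials R.rawRing public using (Poly; coeff; _≋_; _⊕_; _·_; _⊛_)

  infix 8 ⊖_
  ⊖_ : Poly → Poly
  ⊖_ = map λ a → R.- a

  constant : R.Carrier → Poly
  constant a = a ∷ []

  coeff-⊕ : ∀ p q n → coeff (p ⊕ q) n R.≈ coeff p n R.+ coeff q n
  coeff-⊕ []      q       n       = R.sym (R.+-identityˡ _)
  coeff-⊕ (a ∷ p) []      n       = R.sym (R.+-identityʳ _)
  coeff-⊕ (a ∷ p) (b ∷ q) zero    = R.refl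
  coeff-⊕ (a ∷ p) (b ∷ q) (suc n) = coeff-⊕ p q n

  coeff-· : ∀ a p n → coeff (a · p) n R.≈ a R.* coeff p n
  coeff-· a []      n       = R.sym (R.zeroʳ a)
  coeff-· a (b ∷ p) zero    = R.refl
  coeff-· a (b ∷ p) (suc n) = coeff-· a p n

  coeff-⊖ : ∀ p n → coeff (⊖ p) n R.≈ R.- coeff p n
  coeff-⊖ []      n       = R.sym -0#≈0#
    where open RingProperties R.ring
  coeff-⊖ (a ∷ p) zero    = R.refl
  coeff-⊖ (a ∷ p) (suc n) = coeff-⊖ p n

  coeff-⊛ : ∀ p q n → coeff (p ⊛ q) n R.≈ conv (coeff p) (coeff q) n
  coeff-⊛ []      q n = R.sym (conv-zeroˡ (coeff q) (λ _ → R.refl) n)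
  coeff-⊛ (a ∷ p) q n = R.trans (coeff-⊕ (a · q) (R.0# ∷ p ⊛ q) n)
    (R.trans (R.+-congʳ (coeff-· a q n)) (rest n))
    where
    rest : ∀ n → a R.* coeff q n R.+ coeff (R.0# ∷ p ⊛ q) n R.≈ conv (coeff (a ∷ p)) (coeff q) n
    rest zero    = R.+-identityʳ _
    rest (suc n) = R.+-congˡ (coeff-⊛ p q n)

  -- Unlike _≋_, which unfolds to a family of equations, this record lets Agda
  -- infer the two polynomials.
  infix 4 _≃_
  record _≃_ (p q : Poly) : Set ℓ where
    constructor coeffwise
    field at : p ≋ q

  open _≃_ public

  private
    polySetoid : Setoid c ℓ
    polySetoid = record
      { Carrier = Poly ; _≈_ = _≃_
      ; isEquivalence = record
        { refl  = coeffwise λ n → R.refl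
        ; sym   = λ e → coeffwise λ n → R.sym (at e n)
        ; trans = λ e f → coeffwise λ n → R.trans (at e n) (at f n) } }

    open SetoidReasoning R.setoid
    open Consequences polySetoid

    ⊕-cong : ∀ {p q r s} → p ≃ q → r ≃ s → p ⊕ r ≃ q ⊕ s
    ⊕-cong {p} {q} {r} {s} e f .at n =
      R.trans (coeff-⊕ p r n) (R.trans (R.+-cong (at e n) (at f n)) (R.sym (coeff-⊕ q s n)))

    ⊕-comm : ∀ p q → p ⊕ q ≃ q ⊕ p
    ⊕-comm p q .at n = R.trans (coeff-⊕ p q n) (R.trans (R.+-comm _ _) (R.sym (coeff-⊕ q p n)))

    ⊕-assoc : ∀ p q r → (p ⊕ q) ⊕ r ≃ p ⊕ (q ⊕ r)
    ⊕-assoc p q r .at n = begin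
      coeff ((p ⊕ q) ⊕ r) n                      ≈⟨ coeff-⊕ (p ⊕ q) r n ⟩
      coeff (p ⊕ q) n R.+ coeff r n              ≈⟨ R.+-congʳ (coeff-⊕ p q n) ⟩
      coeff p n R.+ coeff q n R.+ coeff r n      ≈⟨ R.+-assoc _ _ _ ⟩
      coeff p n R.+ (coeff q n R.+ coeff r n)    ≈⟨ R.+-congˡ (coeff-⊕ q r n) ⟨
      coeff p n R.+ coeff (q ⊕ r) n              ≈⟨ coeff-⊕ p (q ⊕ r) n ⟨
      coeff (p ⊕ (q ⊕ r)) n                      ∎

    ⊕-identityˡ : ∀ p → [] ⊕ p ≃ p
    ⊕-identityˡ p .at n = R.refl

    ⊖-inverseˡ : ∀ p → ⊖ p ⊕ p ≃ []
    ⊖-inverseˡ p .at n = R.trans (coeff-⊕ (⊖ p) p n)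
      (R.trans (R.+-congʳ (coeff-⊖ p n)) (R.-‿inverseˡ _))

    ⊖-cong : ∀ {p q} → p ≃ q → ⊖ p ≃ ⊖ q
    ⊖-cong {p} {q} e .at n = R.trans (coeff-⊖ p n) (R.trans (R.-‿cong (at e n)) (R.sym (coeff-⊖ q n)))

    ⊛-cong : ∀ {p q r s} → p ≃ q → r ≃ s → p ⊛ r ≃ q ⊛ s
    ⊛-cong {p} {q} {r} {s} e f .at n =
      R.trans (coeff-⊛ p r n) (R.trans (conv-cong (at e) (at f) n) (R.sym (coeff-⊛ q s n)))

    ⊛-comm : ∀ p q → p ⊛ q ≃ q ⊛ p
    ⊛-comm p q .at n = R.trans (coeff-⊛ p q n)
      (R.trans (conv-comm (coeff p) (coeff q) n) (R.sym (coeff-⊛ q p n)))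

    ⊛-assoc : ∀ p q r → (p ⊛ q) ⊛ r ≃ p ⊛ (q ⊛ r)
    ⊛-assoc p q r .at n = begin
      coeff ((p ⊛ q) ⊛ r) n                           ≈⟨ coeff-⊛ (p ⊛ q) r n ⟩
      conv (coeff (p ⊛ q)) (coeff r) n                ≈⟨ conv-cong {g = coeff r} (coeff-⊛ p q) (λ _ → R.refl) n ⟩
      conv (conv (coeff p) (coeff q)) (coeff r) n     ≈⟨ conv-assoc (coeff p) (coeff q) (coeff r) n ⟩
      conv (coeff p) (conv (coeff q) (coeff r)) n     ≈⟨ conv-cong {coeff p} (λ _ → R.refl) (coeff-⊛ q r) n ⟨
      conv (coeff p) (coeff (q ⊛ r)) n                ≈⟨ coeff-⊛ p (q ⊛ r) n ⟨
      coeff (p ⊛ (q ⊛ r)) n                           ∎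

    ⊛-identityˡ : ∀ p → constant R.1# ⊛ p ≃ p
    ⊛-identityˡ p .at n = R.trans (coeff-⊛ (constant R.1#) p n)
      (R.trans (conv-constˡ {coeff (constant R.1#)} (coeff p) (λ _ → R.refl) n) (R.*-identityˡ _))

    ⊛-distribʳ-⊕ : ∀ r p q → (p ⊕ q) ⊛ r ≃ (p ⊛ r) ⊕ (q ⊛ r)
    ⊛-distribʳ-⊕ r p q .at n = begin
      coeff ((p ⊕ q) ⊛ r) n
        ≈⟨ coeff-⊛ (p ⊕ q) r n ⟩
      conv (coeff (p ⊕ q)) (coeff r) n
        ≈⟨ conv-cong {g = coeff r} (coeff-⊕ p q) (λ _ → R.refl) n ⟩
      conv (λ i → coeff p i R.+ coeff q i) (coeff r) n
        ≈⟨ conv-distribʳ (coeff p) (coeff q) (coeff r) n ⟩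
      conv (coeff p) (coeff r) n R.+ conv (coeff q) (coeff r) n
        ≈⟨ R.+-cong (coeff-⊛ p r n) (coeff-⊛ q r n) ⟨
      coeff (p ⊛ r) n R.+ coeff (q ⊛ r) n
        ≈⟨ coeff-⊕ (p ⊛ r) (q ⊛ r) n ⟨
      coeff ((p ⊛ r) ⊕ (q ⊛ r)) n ∎

  polynomialRing : CommutativeRing c ℓ
  polynomialRing = record
    { Carrier = Poly ; _≈_ = _≃_ ; _+_ = _⊕_ ; _*_ = _⊛_ ; -_ = ⊖_ ; 0# = [] ; 1# = constant R.1#
    ; isCommutativeRing = record
      { isRing = record
        { +-isAbelianGroup = record
          { isGroup = record
            { isMonoid = record
              { isSemigroup = record
                { isMagma = record
                  { isEquivalence = Setoid.isEquivalence polySetoid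
                  ; ∙-cong = ⊕-cong }
                ; assoc = ⊕-assoc }
              ; identity = comm∧idˡ⇒id ⊕-comm ⊕-identityˡ }
            ; inverse = comm∧invˡ⇒inv ⊕-comm ⊖-inverseˡ
            ; ⁻¹-cong = ⊖-cong }
          ; comm = ⊕-comm }
        ; *-cong = ⊛-cong
        ; *-assoc = ⊛-assoc
        ; *-identity = comm∧idˡ⇒id ⊛-comm ⊛-identityˡ
        ; distrib = comm∧distrʳ⇒distr ⊕-cong ⊛-comm ⊛-distribʳ-⊕ }
      ; *-comm = ⊛-comm } }

  constant-⊛ : ∀ a p → constant a ⊛ p ≃ a · p
  constant-⊛ a p .at n = R.trans (coeff-⊛ (constant a) p n)
    (R.trans (conv-constˡ {coeff (constant a)} (coeff p) (λ _ → R.refl) n) (R.sym (coeff-· a p n)))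

-- Alternating forms and determinants

module Alternating {c ℓ k} (P : CommutativeRing c ℓ) {K : Set k} (κ : K → CommutativeRing.Carrier P) where

  open CommutativeRing P hiding (zero)
  open SetoidReasoning setoid
  open RingProperties ring
  open CommutativeSemigroupProperties +-commutativeSemigroup using (interchange)
  open CommutativeSemigroupProperties *-commutativeSemigroup using (x∙yz≈y∙xz)

  infix 4 _≈±_
  _≈±_ : Carrier → Carrier → Set ℓ
  a ≈± b = a ≈ b ⊎ a ≈ - b

  ≈±-sym : ∀ {a b} → a ≈± b → b ≈± a
  ≈±-sym (inj₁ e) = inj₁ (sym e)
  ≈±-sym (inj₂ e) = inj₂ (trans (sym (-‿involutive _)) (-‿cong (sym e)))

  ≈±-trans : ∀ {a b c} → a ≈± b → b ≈± c → a ≈± c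
  ≈±-trans (inj₁ e) (inj₁ f) = inj₁ (trans e f)
  ≈±-trans (inj₁ e) (inj₂ f) = inj₂ (trans e f)
  ≈±-trans (inj₂ e) (inj₁ f) = inj₂ (trans e (-‿cong f))
  ≈±-trans (inj₂ e) (inj₂ f) = inj₁ (trans e (trans (-‿cong f) (-‿involutive _)))

  Form : ℕ → Set c
  Form n = Vec Carrier n → Carrier

  -- Homogeneity is asked only for scalars `κ a`: the row operators are linear over the
  -- coefficients, not over the polynomials.
  record IsLinear (f : Carrier → Carrier) : Set (c ⊔ ℓ ⊔ k) where
    field
      congruent   : ∀ {x y} → x ≈ y → f x ≈ f y
      additive    : ∀ x y → f (x + y) ≈ f x + f y
      homogeneous : ∀ a x → f (κ a * x) ≈ κ a * f x

    zero-preserving : f 0# ≈ 0#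
    zero-preserving = x+x≈x⇒x≈0 _ (trans (sym (additive 0# 0#)) (congruent (+-identityˡ 0#)))

  open IsLinear

  VanishesOnRepeat : ∀ {n} → Form (suc n) → Set (c ⊔ ℓ)
  VanishesOnRepeat {zero}  A = Lift _ ⊤
  VanishesOnRepeat {suc n} A = ∀ x xs → A (x ∷ x ∷ xs) ≈ 0#

  -- Recursion through the sections `A (x ∷ _)` yields linearity in every argument while only
  -- adjacent repeats are mentioned; swaps recover the other repeats.
  data IsAlternating : ∀ {n} → Form n → Set (c ⊔ ℓ ⊔ k) where
    nullary : {A : Form 0} → IsAlternating A
    cons    : ∀ {n} {A : Form (suc n)} →
      (∀ xs → IsLinear (λ x → A (x ∷ xs))) →
      (∀ x → IsAlternating (λ xs → A (x ∷ xs))) →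
      VanishesOnRepeat A →
      IsAlternating A

  headLinear : ∀ {n} {A : Form (suc n)} → IsAlternating A → ∀ xs → IsLinear (λ x → A (x ∷ xs))
  headLinear (cons l _ _) = l

  tailAlternating : ∀ {n} {A : Form (suc n)} → IsAlternating A → ∀ x → IsAlternating (λ xs → A (x ∷ xs))
  tailAlternating (cons _ t _) = t

  vanishes : ∀ {n} {A : Form (suc n)} → IsAlternating A → VanishesOnRepeat A
  vanishes (cons _ _ v) = v

  -- Polarisation: A (x + y, x + y, ...) vanishes, and so do two of the four terms of its expansion.
  swap : ∀ {n} {A : Form (suc (suc n))} → IsAlternating A → ∀ x y zs →
    A (x ∷ y ∷ zs) ≈ - A (y ∷ x ∷ zs)
  swap {A = A} alt x y zs = +-inverseˡ-unique _ _ (begin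
    A (x ∷ y ∷ zs) + A (y ∷ x ∷ zs)
      ≈⟨ +-cong (+-identityˡ _) (+-identityʳ _) ⟨
    (0# + A (x ∷ y ∷ zs)) + (A (y ∷ x ∷ zs) + 0#)
      ≈⟨ +-cong (+-congʳ (vanishes alt x zs)) (+-congˡ (vanishes alt y zs)) ⟨
    (A (x ∷ x ∷ zs) + A (x ∷ y ∷ zs)) + (A (y ∷ x ∷ zs) + A (y ∷ y ∷ zs))
      ≈⟨ +-cong (additive (headLinear (tailAlternating alt x) zs) x y)
                (additive (headLinear (tailAlternating alt y) zs) x y) ⟨
    A (x ∷ x + y ∷ zs) + A (y ∷ x + y ∷ zs)
      ≈⟨ additive (headLinear alt (x + y ∷ zs)) x y ⟨
    A (x + y ∷ x + y ∷ zs)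
      ≈⟨ vanishes alt (x + y) zs ⟩
    0# ∎)

  repeat-zero : ∀ {n} {A : Form (suc n)} → IsAlternating A → ∀ (ys : Vec Carrier n) j →
    A (lookup ys j ∷ ys) ≈ 0#
  repeat-zero alt (y ∷ ys) zero    = vanishes alt y ys
  repeat-zero {A = A} alt (y ∷ ys) (suc j) = begin
    A (lookup ys j ∷ y ∷ ys)     ≈⟨ swap alt _ _ _ ⟩
    - A (y ∷ lookup ys j ∷ ys)   ≈⟨ -‿cong (repeat-zero (tailAlternating alt y) ys j) ⟩
    - 0#                         ≈⟨ -0#≈0# ⟩
    0#                           ∎

  bring-to-front : ∀ {n} {A : Form (suc n)} → IsAlternating A → ∀ (ys : Vec Carrier (suc n)) j →
    A (lookup ys j ∷ Vec.removeAt ys j) ≈± A ys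
  bring-to-front alt (y ∷ ys) zero = inj₁ refl
  bring-to-front alt (y ∷ ys@(_ ∷ _)) (suc j) = ≈±-trans (inj₂ (swap alt _ _ _))
    (bring-to-front (tailAlternating alt y) ys j)

  total : ∀ {n} → Vec Carrier n → Carrier
  total = Vec.foldr′ _+_ 0#

  total-removeAt : ∀ {n} (ys : Vec Carrier (suc n)) j → total ys ≈ lookup ys j + total (Vec.removeAt ys j)
  total-removeAt (y ∷ ys) zero = refl
  total-removeAt (y ∷ ys@(_ ∷ _)) (suc j) = trans (+-congˡ (total-removeAt ys j)) (x∙yz≈y∙xz₊ _ _ _)
    where open CommutativeSemigroupProperties +-commutativeSemigroup renaming (x∙yz≈y∙xz to x∙yz≈y∙xz₊)

  total-zero : ∀ {n} {f : Carrier → Carrier} → IsLinear f → (ys : Vec Carrier n) →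
    (∀ j → f (lookup ys j) ≈ 0#) → f (total ys) ≈ 0#
  total-zero l []       z = zero-preserving l
  total-zero l (y ∷ ys) z = trans (additive l _ _)
    (trans (+-cong (z zero) (total-zero l ys (z ∘ suc))) (+-identityˡ 0#))

  -- Let zs be the entries other than the head x and the one at position j of the tail. Put the zero
  -- total in front of zs: by linearity every summand taken from zs gives a repeat and vanishes, so
  -- the two remaining values are opposite. Moving the entry j back into place costs a further sign.
  omit-agree : ∀ {n} {A : Form n} → IsAlternating A → ∀ ys → total ys ≈ 0# → ∀ j →
    A (Vec.removeAt ys j) ≈± A (Vec.removeAt ys zero)
  omit-agree alt (x ∷ ys) Σ≈0 zero = inj₁ refl
  omit-agree {A = A} alt (x ∷ ys@(_ ∷ _)) Σ≈0 (suc j) =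
    ≈±-trans (inj₂ (+-inverseˡ-unique _ _ sum-zero)) (bring-to-front alt ys j)
    where
    zs = Vec.removeAt ys j
    lin = headLinear alt zs
    sum-zero : A (x ∷ zs) + A (lookup ys j ∷ zs) ≈ 0#
    sum-zero = begin
      A (x ∷ zs) + A (lookup ys j ∷ zs)
        ≈⟨ +-congˡ (+-identityʳ _) ⟨
      A (x ∷ zs) + (A (lookup ys j ∷ zs) + 0#)
        ≈⟨ +-congˡ (+-congˡ (total-zero lin zs (repeat-zero alt zs))) ⟨
      A (x ∷ zs) + (A (lookup ys j ∷ zs) + A (total zs ∷ zs))
        ≈⟨ +-congˡ (additive lin _ _) ⟨
      A (x ∷ zs) + A (lookup ys j + total zs ∷ zs)
        ≈⟨ additive lin _ _ ⟨
      A (x + (lookup ys j + total zs) ∷ zs)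
        ≈⟨ congruent lin (trans (+-congˡ (sym (total-removeAt ys j))) Σ≈0) ⟩
      A (0# ∷ zs)
        ≈⟨ zero-preserving lin ⟩
      0# ∎

  -- An elementary column operation: the multiple of x added to y repeats x and contributes nothing.
  -- Two swaps carry y past x, so that the induction can run in the section at y.
  add-multiples : ∀ {n} {A : Form (suc n)} → IsAlternating A → ∀ x (t : Carrier → K) ys →
    A (x ∷ Vec.map (λ y → y + κ (t y) * x) ys) ≈ A (x ∷ ys)
  add-multiples alt x t [] = refl
  add-multiples {A = A} alt x t (y ∷ ys) = begin
    A (x ∷ y + κ (t y) * x ∷ ys′)                   ≈⟨ additive lin _ _ ⟩
    A (x ∷ y ∷ ys′) + A (x ∷ κ (t y) * x ∷ ys′)     ≈⟨ +-congˡ (homogeneous lin _ _) ⟩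
    A (x ∷ y ∷ ys′) + κ (t y) * A (x ∷ x ∷ ys′)     ≈⟨ +-congˡ (*-congˡ (vanishes alt x ys′)) ⟩
    A (x ∷ y ∷ ys′) + κ (t y) * 0#                  ≈⟨ +-congˡ (zeroʳ _) ⟩
    A (x ∷ y ∷ ys′) + 0#                            ≈⟨ +-identityʳ _ ⟩
    A (x ∷ y ∷ ys′)                                 ≈⟨ swap alt _ _ _ ⟩
    - A (y ∷ x ∷ ys′)                               ≈⟨ -‿cong (add-multiples (tailAlternating alt y) x t ys) ⟩
    - A (y ∷ x ∷ ys)                                ≈⟨ swap alt _ _ _ ⟨
    A (x ∷ y ∷ ys)                                  ∎
    where
    ys′ = Vec.map (λ y → y + κ (t y) * x) ys
    lin = headLinear (tailAlternating alt x) ys′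

  -- Laplace expansion along the row L; the nested subtractions produce the alternating signs. An
  -- arbitrary form A stands in for the minors so that the recursion can pass to its sections.
  wedge : ∀ {n} → (Carrier → Carrier) → Form n → Form (suc n)
  wedge {zero}  L A (x ∷ []) = L x * A []
  wedge {suc n} L A (x ∷ xs) = L x * A xs - wedge L (λ ys → A (x ∷ ys)) xs

  wedge-+ : ∀ {n} L {A B C : Form n} → (∀ ys → A ys ≈ B ys + C ys) → ∀ xs →
    wedge L A xs ≈ wedge L B xs + wedge L C xs
  wedge-+ {zero}  L e (x ∷ []) = trans (*-congˡ (e [])) (distribˡ _ _ _)
  wedge-+ {suc n} L {A} {B} {C} e (x ∷ xs) = begin
    L x * A xs - wedge L _ xs
      ≈⟨ +-cong (trans (*-congˡ (e xs)) (distribˡ _ _ _))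
                (trans (-‿cong (wedge-+ L (λ ys → e (x ∷ ys)) xs)) (sym (-‿+-comm _ _))) ⟩
    (L x * B xs + L x * C xs) + (- wedge L _ xs + - wedge L _ xs)
      ≈⟨ interchange _ _ _ _ ⟩
    wedge L B (x ∷ xs) + wedge L C (x ∷ xs) ∎

  wedge-* : ∀ {n} L a {A B : Form n} → (∀ ys → A ys ≈ a * B ys) → ∀ xs →
    wedge L A xs ≈ a * wedge L B xs
  wedge-* {zero}  L a e (x ∷ []) = trans (*-congˡ (e [])) (x∙yz≈y∙xz _ _ _)
  wedge-* {suc n} L a {A} {B} e (x ∷ xs) = begin
    L x * A xs - wedge L _ xs
      ≈⟨ +-cong (trans (*-congˡ (e xs)) (x∙yz≈y∙xz _ _ _))
                (-‿cong (wedge-* L a (λ ys → e (x ∷ ys)) xs)) ⟩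
    a * (L x * B xs) - a * wedge L _ xs
      ≈⟨ x[y-z]≈xy-xz _ _ _ ⟨
    a * wedge L B (x ∷ xs) ∎

  wedge-cong : ∀ {n} L {A B : Form n} → (∀ ys → A ys ≈ B ys) → ∀ xs → wedge L A xs ≈ wedge L B xs
  wedge-cong L e xs = trans (wedge-* L 1# (λ ys → trans (e ys) (sym (*-identityˡ _))) xs) (*-identityˡ _)

  wedge-zero : ∀ {n} L {A : Form n} → (∀ ys → A ys ≈ 0#) → ∀ xs → wedge L A xs ≈ 0#
  wedge-zero L {A} e xs = trans (wedge-* L 0# {A} {A} (λ ys → trans (e ys) (sym (zeroˡ _))) xs) (zeroˡ _)

  private
    linear-combination : ∀ {f g : Carrier → Carrier} c → IsLinear f → IsLinear g →
      IsLinear (λ x → c * f x - g x)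
    linear-combination c f g .congruent e = +-cong (*-congˡ (congruent f e)) (-‿cong (congruent g e))
    linear-combination c f g .additive x y = trans
      (+-cong (trans (*-congˡ (additive f x y)) (distribˡ _ _ _))
              (trans (-‿cong (additive g x y)) (sym (-‿+-comm _ _))))
      (interchange _ _ _ _)
    linear-combination c f g .homogeneous a x = trans
      (+-cong (trans (*-congˡ (homogeneous f a x)) (x∙yz≈y∙xz _ _ _)) (-‿cong (homogeneous g a x)))
      (sym (x[y-z]≈xy-xz _ _ _))

    alternating-combination : ∀ {n} {A B : Form n} c → IsAlternating A → IsAlternating B →
      IsAlternating (λ xs → c * A xs - B xs)
    alternating-combination c nullary nullary = nullary
    alternating-combination {suc n} {A} {B} c (cons l t v) (cons l′ t′ v′) = cons
      (λ xs → linear-combination c (l xs) (l′ xs))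
      (λ x → alternating-combination c (t x) (t′ x))
      (vanish n A B v v′)
      where
      vanish : ∀ n (A B : Form (suc n)) → VanishesOnRepeat A → VanishesOnRepeat B →
        VanishesOnRepeat (λ xs → c * A xs - B xs)
      vanish zero    A B v v′ = _
      vanish (suc n) A B v v′ x xs = trans
        (+-cong (trans (*-congˡ (v x xs)) (zeroʳ c)) (trans (-‿cong (v′ x xs)) -0#≈0#)) (+-identityˡ 0#)

  wedge-linear : ∀ {n L} {A : Form n} → IsLinear L → IsAlternating A → ∀ xs →
    IsLinear (λ x → wedge L A (x ∷ xs))
  wedge-linear {zero} l a [] = record
    { congruent   = λ e → *-congʳ (congruent l e)
    ; additive    = λ x y → trans (*-congʳ (additive l x y)) (distribʳ _ _ _)
    ; homogeneous = λ b x → trans (*-congʳ (homogeneous l b x)) (*-assoc _ _ _) }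
  wedge-linear {suc n} {L} {A} l a xs = record
    { congruent   = λ e → +-cong (*-congʳ (congruent l e))
        (-‿cong (wedge-cong L (λ ys → congruent (headLinear a ys) e) xs))
    ; additive    = λ x y → trans
        (+-cong (trans (*-congʳ (additive l x y)) (distribʳ _ _ _))
                (trans (-‿cong (wedge-+ L (λ ys → additive (headLinear a ys) x y) xs)) (sym (-‿+-comm _ _))))
        (interchange _ _ _ _)
    ; homogeneous = λ b x → trans
        (+-cong (trans (*-congʳ (homogeneous l b x)) (*-assoc _ _ _))
                (-‿cong (wedge-* L (κ b) (λ ys → homogeneous (headLinear a ys) b x) xs)))
        (sym (x[y-z]≈xy-xz _ _ _)) }

  -- The product L x * A (x ∷ xs) occurs twice with opposite signs, and what remains expands a form
  -- that is already zero.
  wedge-repeat : ∀ {n L} {A : Form n} → IsAlternating A → VanishesOnRepeat (wedge L A)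
  wedge-repeat {zero} a = _
  wedge-repeat {suc zero} {L} {A} a x [] = -‿inverseʳ _
  wedge-repeat {suc (suc n)} {L} {A} a x xs = begin
    L x * A (x ∷ xs) - (L x * A (x ∷ xs) - wedge L (λ ys → A (x ∷ x ∷ ys)) xs)
      ≈⟨ +-congˡ (-‿cong (+-congˡ (trans (-‿cong (wedge-zero L (vanishes a x) xs)) -0#≈0#))) ⟩
    L x * A (x ∷ xs) - (L x * A (x ∷ xs) + 0#)
      ≈⟨ +-congˡ (-‿cong (+-identityʳ _)) ⟩
    L x * A (x ∷ xs) - L x * A (x ∷ xs)
      ≈⟨ -‿inverseʳ _ ⟩
    0# ∎

  wedge-alternating : ∀ {n L} {A : Form n} → IsLinear L → IsAlternating A → IsAlternating (wedge L A)
  wedge-alternating {zero} l a = cons (wedge-linear l a) (λ _ → nullary) _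
  wedge-alternating {suc n} {L} l a = cons (wedge-linear l a)
    (λ x → alternating-combination (L x) a (wedge-alternating l (tailAlternating a x)))
    (wedge-repeat a)

  -- The determinant of the matrix with entries Lᵢ xⱼ: operators index the rows, arguments the
  -- columns.
  det : ∀ {n} → Vec (Carrier → Carrier) n → Form n
  det []       [] = 1#
  det (L ∷ Ls)    = wedge L (det Ls)

  det-alternating : ∀ {n} {Ls : Vec (Carrier → Carrier) n} → All IsLinear Ls → IsAlternating (det Ls)
  det-alternating []       = nullary
  det-alternating (l ∷ ls) = wedge-alternating l (det-alternating ls)

  -- A determinant is made from its entries by subtraction and multiplication, so a property graded
  -- by a commutative monoid that survives both passes from the columns to the determinant. The
  -- instances are degree bounds in (ℤ, +) and divisors in (ℂ[x], *). `Pre` is the condition on a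
  -- column, which may differ from the bound `B` on its entries.
  module Bounds {m ℓm b p} (M : CommutativeMonoid m ℓm)
    (B : Carrier → CommutativeMonoid.Carrier M → Set b)
    (B-respʳ : ∀ {x m m′} → CommutativeMonoid._≈_ M m m′ → B x m → B x m′)
    (B-1 : B 1# (CommutativeMonoid.ε M))
    (B-- : ∀ {x y m} → B x m → B y m → B (x - y) m)
    (B-* : ∀ {x y m n} → B x m → B y n → B (x * y) (CommutativeMonoid._∙_ M m n))
    (Pre : Carrier → CommutativeMonoid.Carrier M → Set p)
    where

    private module M = CommutativeMonoid M
    open CommutativeSemigroupProperties M.commutativeSemigroup renaming (x∙yz≈y∙xz to m∙no≈n∙mo)

    product : ∀ {n} → Vec M.Carrier n → M.Carrier
    product = Vec.foldr′ M._∙_ M.ε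

    -- `d` accounts for the arguments already fixed when the form is a section of a larger one.
    Bounded : ∀ {n} → Form n → M.Carrier → Set _
    Bounded {n} A d = ∀ {xs} {ms : Vec M.Carrier n} → Pointwise Pre xs ms → B (A xs) (d M.∙ product ms)

    wedge-bounded : ∀ {n L d} {A : Form n} → (∀ {x m} → Pre x m → B (L x) m) → Bounded A d →
      Bounded (wedge L A) d
    wedge-bounded {zero}  l a (p ∷ []) = B-respʳ (m∙no≈n∙mo _ _ _) (B-* (l p) (a []))
    wedge-bounded {suc n} l a (p ∷ ps) = B--
      (B-respʳ (m∙no≈n∙mo _ _ _) (B-* (l p) (a ps)))
      (B-respʳ (M.assoc _ _ _)
        (wedge-bounded l (λ qs → B-respʳ (M.sym (M.assoc _ _ _)) (a (p ∷ qs))) ps))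

    det-bounded : ∀ {n} {Ls : Vec (Carrier → Carrier) n} →
      All (λ L → ∀ {x m} → Pre x m → B (L x) m) Ls → Bounded (det Ls) M.ε
    det-bounded []       [] = B-respʳ (M.sym (M.identityˡ _)) B-1
    det-bounded (l ∷ ls)    = wedge-bounded l (det-bounded ls)

-- Double negation as a monad, and fields without decidable equality

infixl 1 _>>=_
_>>=_ : ∀ {a b} {A : Set a} {B : Set b} → ¬ ¬ A → (A → ¬ ¬ B) → ¬ ¬ B
(m >>= f) k = m λ a → f a k

return : ∀ {a} {A : Set a} → A → ¬ ¬ A
return a k = k a

all-or-counterexample : ∀ {n p} (P : Fin n → Set p) → (∀ i → ¬ ¬ P i → P i) →
  ¬ ¬ ((∀ i → P i) ⊎ ∃ λ i → ¬ P i)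
all-or-counterexample P stable k = k (inj₁ λ i → stable i λ ¬Pi → k (inj₂ (i , ¬Pi)))

-- The facts about ℂ that survive without decidable equality and suffice below.
record IsWeakField {c ℓ} (R : CommutativeRing c ℓ) : Set (c ⊔ ℓ) where
  open CommutativeRing R
  open Mult +-monoid using () renaming (_×_ to _×ₘ_)
  field
    stable  : ∀ {a b} → ¬ ¬ (a ≈ b) → a ≈ b
    inverse : ∀ {a} → ¬ (a ≈ 0#) → ¬ ¬ (∃ λ b → a * b ≈ 1#)
    char0   : ∀ n → ¬ (suc n ×ₘ 1# ≈ 0#)

-- Degrees and degree bounds

module PolynomialDegree {c ℓ} (R : CommutativeRing c ℓ) (isWeakField : IsWeakField R) where

  open PolynomialRing R public
  open IsWeakField isWeakField public
  module R = CommutativeRing R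
  module P = CommutativeRing polynomialRing
  open Polynomials R.rawRing using (_^_)

  1≉0 : ¬ (R.1# R.≈ R.0#)
  1≉0 e = char0 0 (R.trans (R.+-identityʳ _) e)

  -- The inverse exists only under double negation, which stability of the equation to be proved
  -- removes.
  *-cancel-zero : ∀ {a b} → ¬ (a R.≈ R.0#) → a R.* b R.≈ R.0# → b R.≈ R.0#
  *-cancel-zero {a} {b} a≉0 ab≈0 = stable (inverse a≉0 >>= λ (a⁻¹ , aa⁻¹≈1) → return (begin
    b                    ≈⟨ R.*-identityˡ b ⟨
    R.1# R.* b           ≈⟨ R.*-congʳ (R.trans (R.*-comm a⁻¹ a) aa⁻¹≈1) ⟨
    a⁻¹ R.* a R.* b      ≈⟨ R.*-assoc _ _ _ ⟩
    a⁻¹ R.* (a R.* b)    ≈⟨ R.*-congˡ ab≈0 ⟩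
    a⁻¹ R.* R.0#         ≈⟨ R.zeroʳ a⁻¹ ⟩
    R.0#                 ∎))
    where open SetoidReasoning R.setoid

  *-nonzero : ∀ {a b} → ¬ (a R.≈ R.0#) → ¬ (b R.≈ R.0#) → ¬ (a R.* b R.≈ R.0#)
  *-nonzero a≉0 b≉0 ab≈0 = b≉0 (*-cancel-zero a≉0 ab≈0)

  record HasDegree (p : Poly) (d : ℕ) : Set ℓ where
    constructor degree
    field
      leading : ¬ (coeff p d R.≈ R.0#)
      above   : ∀ n → d ℕ.< n → coeff p n R.≈ R.0#

  open HasDegree public

  degree-resp : ∀ {p q d} → p ≃ q → HasDegree p d → HasDegree q d
  degree-resp e h .leading z     = leading h (R.trans (at e _) z)
  degree-resp e h .above   n d<n = R.trans (R.sym (at e n)) (above h n d<n)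

  degree-unique : ∀ {p d e} → HasDegree p d → HasDegree p e → d ≡ e
  degree-unique h h′ = ℕ.≤-antisym
    (ℕ.≮⇒≥ λ e<d → leading h (above h′ _ e<d)) (ℕ.≮⇒≥ λ d<e → leading h′ (above h _ d<e))

  degree-exists : ∀ p → ¬ (p ≃ []) → ¬ ¬ ∃ (HasDegree p)
  degree-exists []      p≄0 _ = p≄0 P.refl
  degree-exists (a ∷ p) p≄0   = ¬¬-excluded-middle {A = p ≃ []} >>= λ where
    (no ¬p≃0) → degree-exists p ¬p≃0 >>= λ (d , h) →
      return (suc d , degree (leading h) λ { (suc n) (ℕ.s≤s d<n) → above h n d<n })
    (yes p≃0) → return (0 , degree
      (λ a≈0 → p≄0 (coeffwise λ { zero → a≈0 ; (suc n) → at p≃0 n }))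
      λ { (suc n) _ → at p≃0 n })

  degree-nonzero : ∀ {p d} → HasDegree p d → ¬ (p ≃ [])
  degree-nonzero h p≃0 = leading h (at p≃0 _)

  coeff-top : ∀ p q d e → (∀ n → d ℕ.< n → coeff p n R.≈ R.0#) → (∀ n → e ℕ.< n → coeff q n R.≈ R.0#) →
    coeff (p ⊛ q) (d ℕ.+ e) R.≈ coeff p d R.* coeff q e
  coeff-top p q d e p↑ q↑ = R.trans (coeff-⊛ p q _) (conv-top (coeff p) (coeff q) d e p↑ q↑)

  -- Bounds are integers because the argument lowers a bound by one, possibly below 0.
  infix 4 _hasBound_
  record _hasBound_ (p : Poly) (b : ℤ) : Set ℓ where
    constructor bounded
    field beyond : ∀ n → b ℤ.< + n → coeff p n R.≈ R.0#

  open _hasBound_ public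

  bound-resp : ∀ {p b b′} → b ≡ b′ → p hasBound b → p hasBound b′
  bound-resp ≡.refl h = h

  bound-one : constant R.1# hasBound ℤ.0ℤ
  bound-one = bounded λ { (suc n) _ → R.refl ; zero (ℤ.+<+ ()) }

  bound-- : ∀ {p q b} → p hasBound b → q hasBound b → (p P.- q) hasBound b
  bound-- {p} {q} hp hq .beyond n b<n = R.trans (coeff-⊕ p (⊖ q) n) (R.trans
    (R.+-cong (beyond hp n b<n) (R.trans (coeff-⊖ q n) (R.trans (R.-‿cong (beyond hq n b<n)) -0#≈0#))) (R.+-identityˡ _))
    where open RingProperties R.ring

  bound-* : ∀ {p q b b′} → p hasBound b → q hasBound b′ → (p ⊛ q) hasBound (b ℤ.+ b′)
  bound-* {p} {q} {b} {b′} hp hq .beyond n b+b′<n = R.trans (coeff-⊛ p q n)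
    (conv-vanish (coeff p) (coeff q) n term)
    where
    term : ∀ i j → i ℕ.+ j ≡ n → coeff p i R.* coeff q j R.≈ R.0#
    term i j ≡.refl with b ℤ.<? + i
    ... | yes b<i = R.trans (R.*-congʳ (beyond hp i b<i)) (R.zeroˡ _)
    ... | no  b≮i = R.trans (R.*-congˡ (beyond hq j (ℤ.≰⇒> λ j≤b′ →
            ℤ.<⇒≱ b+b′<n (ℤ.+-mono-≤ (ℤ.≮⇒≥ b≮i) j≤b′)))) (R.zeroʳ _)

  degree⇒bound : ∀ {p d} → HasDegree p d → p hasBound (+ d)
  degree⇒bound h .beyond n (ℤ.+<+ d<n) = above h n d<n

  bound⇒degree-≤ : ∀ {p d e} → HasDegree p d → p hasBound (+ e) → d ℕ.≤ e
  bound⇒degree-≤ h b = ℕ.≮⇒≥ λ e<d → leading h (beyond b _ (ℤ.+<+ e<d))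

  degree-* : ∀ {p q d e} → HasDegree p d → HasDegree q e → HasDegree (p ⊛ q) (d ℕ.+ e)
  degree-* {p} {q} {d} {e} h h′ .leading z =
    *-nonzero (leading h) (leading h′) (R.trans (R.sym (coeff-top p q d e (above h) (above h′))) z)
  degree-* h h′ .above n d+e<n =
    beyond (bound-* (degree⇒bound h) (degree⇒bound h′)) n (ℤ.+<+ d+e<n)

  degree-one : HasDegree (constant R.1#) 0
  degree-one = degree 1≉0 λ { (suc n) _ → R.refl }

  degree-^ : ∀ {p d} k → HasDegree p d → HasDegree (p ^ k) (k ℕ.* d)
  degree-^ zero    h = degree-one
  degree-^ (suc k) h = degree-* h (degree-^ k h)

  constant-* : ∀ a b → constant (a R.* b) ≃ constant a ⊛ constant b
  constant-* a b = P.sym (constant-⊛ a (constant b))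

  constant-0 : constant R.0# ≃ []
  constant-0 = coeffwise λ { zero → R.refl ; (suc n) → R.refl }

-- Division with remainder and greatest common divisors

module RingLemmas {c ℓ} (R : CommutativeRing c ℓ) where

  open CommutativeRing R
  open SemiringDivisibility semiring
  open RingProperties ring
  open CommutativeSemigroupProperties +-commutativeSemigroup using (interchange)
  open SetoidReasoning setoid

  ∣-+ : ∀ {x y z} → x ∣ y → x ∣ z → x ∣ y + z
  ∣-+ (p , e) (q , f) = (p + q) , trans (distribʳ _ p q) (+-cong e f)

  ∣-- : ∀ {x y z} → x ∣ y → x ∣ z → x ∣ y - z
  ∣-- (p , e) (q , f) = (p - q) , trans ([y-z]x≈yx-zx _ p q) (+-cong e (-‿cong f))

  -- The bookkeeping of a division step: u, a multiple of the divisor, moves from the remainder r to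
  -- the part v already divided off.
  transfer : ∀ u v r → v + r ≈ (u + v) + (r - u)
  transfer u v r = begin
    v + r                  ≈⟨ +-identityˡ _ ⟨
    0# + (v + r)           ≈⟨ +-congʳ (-‿inverseʳ u) ⟨
    (u - u) + (v + r)      ≈⟨ interchange _ _ _ _ ⟩
    (u + v) + (- u + r)    ≈⟨ +-congˡ (+-comm _ _) ⟩
    (u + v) + (r - u)      ∎

  collect : ∀ a y t x b w → a * (y + t * x) + (b * x + w) ≈ (a * t + b) * x + (a * y + w)
  collect a y t x b w = begin
    a * (y + t * x) + (b * x + w)            ≈⟨ +-congʳ (trans (distribˡ a y (t * x)) (+-comm _ _)) ⟩
    (a * (t * x) + a * y) + (b * x + w)      ≈⟨ interchange _ _ _ _ ⟩
    (a * (t * x) + b * x) + (a * y + w)      ≈⟨ +-congʳ (+-congʳ (*-assoc a t x)) ⟨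
    (a * t * x + b * x) + (a * y + w)        ≈⟨ +-congʳ (distribʳ x (a * t) b) ⟨
    (a * t + b) * x + (a * y + w)            ∎

  -- For Euclid's algorithm: a divisor of a w and b w also divides r w.
  remainder-multiple : ∀ a s b r w → a ≈ s * b + r → a * w - s * (b * w) ≈ r * w
  remainder-multiple a s b r w e = begin
    a * w - s * (b * w)     ≈⟨ +-congˡ (-‿cong (*-assoc s b w)) ⟨
    a * w - s * b * w       ≈⟨ [y-z]x≈yx-zx w a (s * b) ⟨
    (a - s * b) * w         ≈⟨ *-congʳ (+-congʳ e) ⟩
    (s * b + r - s * b) * w ≈⟨ *-congʳ (xyx⁻¹≈y (s * b) r) ⟩
    r * w                   ∎

module GCD {c ℓ} (R : CommutativeRing c ℓ) (isWeakField : IsWeakField R) where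

  open PolynomialDegree R isWeakField
  open SemiringDivisibility P.semiring
  open RingLemmas polynomialRing

  infix 4 _<°_
  _<°_ : Poly → ℕ → Set ℓ
  p <° n = ∀ i → n ℕ.≤ i → coeff p i R.≈ R.0#

  -- Horner's scheme. If r is the remainder of p, then a + x r serves for a + x p except that its
  -- coefficient at N may survive; one multiple of b clears it. The inverse t of the leading
  -- coefficient is supplied from outside because it is found only under double negation.
  divMod : ∀ b N t → b <° suc N → coeff b N R.* t R.≈ R.1# → ∀ a →
    ∃ λ s → ∃ λ r → a ≃ s ⊛ b ⊕ r × r <° N
  divMod b N t b< bt []      = [] , [] , P.refl , λ _ _ → R.refl
  divMod b N t b< bt (a ∷ p) with divMod b N t b< bt p
  ... | s , r , p≃sb+r , r< = u ∷ s , r₁ ⊕ (⊖ (u · b)) , eq , bound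
    where
    r₁ = a ∷ r
    u  = coeff r₁ N R.* t
    eq : a ∷ p ≃ (u · b ⊕ (R.0# ∷ s ⊛ b)) ⊕ (r₁ ⊕ (⊖ (u · b)))
    eq = P.trans (coeffwise (λ { zero → R.sym (R.+-identityˡ a) ; (suc n) → at p≃sb+r n }))
                 (transfer (u · b) (R.0# ∷ s ⊛ b) r₁)
    r₁< : ∀ i → suc N ℕ.≤ i → coeff r₁ i R.≈ R.0#
    r₁< (suc i) (ℕ.s≤s N≤i) = r< i N≤i
    coeff-r : ∀ i → coeff (r₁ ⊕ (⊖ (u · b))) i R.≈ coeff r₁ i R.- u R.* coeff b i
    coeff-r i = R.trans (coeff-⊕ r₁ (⊖ (u · b)) i)
      (R.+-congˡ (R.trans (coeff-⊖ (u · b) i) (R.-‿cong (coeff-· u b i))))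
    ubN : u R.* coeff b N R.≈ coeff r₁ N
    ubN = R.trans (R.*-assoc _ _ _) (R.trans (R.*-congˡ (R.trans (R.*-comm _ _) bt)) (R.*-identityʳ _))
    bound : ∀ i → N ℕ.≤ i → coeff (r₁ ⊕ (⊖ (u · b))) i R.≈ R.0#
    bound i N≤i with ℕ.m≤n⇒m<n∨m≡n N≤i
    ... | inj₁ N<i = R.trans (coeff-r i) (R.trans (R.+-cong (r₁< i N<i)
            (R.-‿cong (R.trans (R.*-congˡ (b< i N<i)) (R.zeroʳ u)))) (R.-‿inverseʳ _))
    ... | inj₂ ≡.refl = R.trans (coeff-r N) (R.trans (R.+-congˡ (R.-‿cong ubN)) (R.-‿inverseʳ _))

  -- Bézout without cofactors: d lies in the ideal of the members of s, tested
  -- against the ideals { x | a ∣ x w }.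
  InIdeal : Poly → ∀ {n} → Vec Poly n → Set _
  InIdeal d s = ∀ a w → (∀ i → a ∣ lookup s i ⊛ w) → a ∣ d ⊛ w

  IsGCD : Poly → ∀ {n} → Vec Poly n → Set _
  IsGCD d s = (∀ i → d ∣ lookup s i) × InIdeal d s

  -- The induction is on a bound for b rather than on its degree: a vanishing top coefficient simply
  -- lowers the bound, so each round asks about a single equation.
  euclid : ∀ N a b → b <° N → ¬ ¬ ∃ λ d → IsGCD d (a ∷ b ∷ [])
  euclid zero a b b<0 = return (a , (λ { zero → ∣ʳ-refl
                                       ; (suc zero) → ∣ʳ-respʳ-≈ (P.sym (coeffwise λ n → b<0 n ℕ.z≤n)) (a ∣0) })
                                 , λ x w h → h zero)
  euclid (suc N) a b b< = ¬¬-excluded-middle {A = coeff b N R.≈ R.0#} >>= λ where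
      (yes bN≈0) → euclid N a b λ i N≤i → case bN≈0 i (ℕ.m≤n⇒m<n∨m≡n N≤i)
      (no  bN≉0) → inverse bN≉0 >>= λ (t , bt≈1) → step (divMod b N t b< bt≈1 a)
    where
    case : coeff b N R.≈ R.0# → ∀ i → N ℕ.< i ⊎ N ≡ i → coeff b i R.≈ R.0#
    case bN≈0 i (inj₁ N<i)    = b< i N<i
    case bN≈0 i (inj₂ ≡.refl) = bN≈0
    step : (∃ λ s → ∃ λ r → a ≃ s ⊛ b ⊕ r × r <° N) → ¬ ¬ ∃ λ d → IsGCD d (a ∷ b ∷ [])
    step (s , r , a≃sb+r , r<) = euclid N b r r< >>= λ (d , d∣ , ideal) → return (d
      , (λ { zero → ∣ʳ-respʳ-≈ (P.sym a≃sb+r) (∣-+ (x∣ʳy⇒x∣ʳzy s (d∣ zero)) (d∣ (suc zero)))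
           ; (suc zero) → d∣ zero })
      , λ x w h → ideal x w λ
          { zero → h (suc zero)
          ; (suc zero) → ∣ʳ-respʳ-≈ (remainder-multiple a s b r w a≃sb+r) (∣-- (h zero) (x∣ʳy⇒x∣ʳzy s (h (suc zero)))) })

  bounded-by-length : ∀ p → p <° length p
  bounded-by-length []      i       _           = R.refl
  bounded-by-length (a ∷ p) (suc i) (ℕ.s≤s h) = bounded-by-length p i h

  gcd-exists : ∀ {n} (s : Vec Poly n) → ¬ ¬ ∃ λ d → IsGCD d s
  -- Without generators the ideal is zero, and so is its generator.
  gcd-exists []       = return ([] , (λ ()) , λ a w _ → a ∣0)
  gcd-exists (a ∷ s) =
    gcd-exists s >>= λ (d , d∣ , d-ideal) →
    euclid _ a d (bounded-by-length d) >>= λ (e , e∣ , e-ideal) → return (e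
      , (λ { zero → e∣ zero ; (suc i) → ∣ʳ-trans (e∣ (suc zero)) (d∣ i) })
      , λ x w h → e-ideal x w λ { zero → h zero ; (suc zero) → d-ideal x w (h ∘ suc) })

-- Wronskians with shifted Euler operators as rows

module Wronskian {c ℓ} (R : CommutativeRing c ℓ) (isWeakField : IsWeakField R) where

  open PolynomialDegree R isWeakField public
  open Alternating polynomialRing constant public
  open Mult R.+-monoid using (×-homo-+) renaming (_×_ to _×ₘ_)
  private module RP = RingProperties R.ring
  open Polynomials R.rawRing using (_^_)

  -- Powers of x are eigenvectors with eigenvalues w n; linearity, degree bounds and the survival of
  -- leading coefficients are all read off from w.
  record IsDiagonal (w : ℕ → R.Carrier) (L : Poly → Poly) : Set (c ⊔ ℓ) where
    constructor diagonal
    field coeff-scaled : ∀ p n → coeff (L p) n R.≈ w n R.* coeff p n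

  open IsDiagonal

  diagonal-linear : ∀ {w L} → IsDiagonal w L → IsLinear L
  diagonal-linear {w} {L} diag = record
    { congruent   = λ {p} {q} e → coeffwise λ n →
        R.trans (coeff-scaled diag p n) (R.trans (R.*-congˡ (at e n)) (R.sym (coeff-scaled diag q n)))
    ; additive    = λ p q → coeffwise λ n → begin
        coeff (L (p ⊕ q)) n                         ≈⟨ coeff-scaled diag (p ⊕ q) n ⟩
        w n R.* coeff (p ⊕ q) n                     ≈⟨ R.*-congˡ (coeff-⊕ p q n) ⟩
        w n R.* (coeff p n R.+ coeff q n)           ≈⟨ R.distribˡ _ _ _ ⟩
        w n R.* coeff p n R.+ w n R.* coeff q n     ≈⟨ R.+-cong (coeff-scaled diag p n) (coeff-scaled diag q n) ⟨
        coeff (L p) n R.+ coeff (L q) n             ≈⟨ coeff-⊕ (L p) (L q) n ⟨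
        coeff (L p ⊕ L q) n                         ∎
    ; homogeneous = λ a p → coeffwise λ n → begin
        coeff (L (constant a ⊛ p)) n                ≈⟨ coeff-scaled diag (constant a ⊛ p) n ⟩
        w n R.* coeff (constant a ⊛ p) n            ≈⟨ R.*-congˡ (coeff-constant a p n) ⟩
        w n R.* (a R.* coeff p n)                   ≈⟨ x∙yz≈y∙xz _ _ _ ⟩
        a R.* (w n R.* coeff p n)                   ≈⟨ R.*-congˡ (coeff-scaled diag p n) ⟨
        a R.* coeff (L p) n                         ≈⟨ coeff-constant a (L p) n ⟨
        coeff (constant a ⊛ L p) n                  ∎ }
    where
    open SetoidReasoning R.setoid
    open CommutativeSemigroupProperties R.*-commutativeSemigroup using (x∙yz≈y∙xz)
    coeff-constant : ∀ a p n → coeff (constant a ⊛ p) n R.≈ a R.* coeff p n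
    coeff-constant a p n = R.trans (at (constant-⊛ a p) n) (coeff-· a p n)

  diagonal-bound : ∀ {w L p b} → IsDiagonal w L → p hasBound b → L p hasBound b
  diagonal-bound diag h .beyond n b<n = R.trans (coeff-scaled diag _ n) (R.trans (R.*-congˡ (beyond h n b<n)) (R.zeroʳ _))

  ι : ℕ → R.Carrier
  ι n = n ×ₘ R.1#

  ι-distinct : ∀ {m n} → m ℕ.< n → ¬ (ι m R.- ι n R.≈ R.0#)
  ι-distinct {m} {n} m<n e with ℕ.m≤n⇒∃[o]m+o≡n m<n
  ... | k , ≡.refl = char0 k (RP.+-identityʳ-unique (ι m) (ι (suc k)) (begin
      ι m R.+ ι (suc k)     ≈⟨ ×-homo-+ R.1# m (suc k) ⟨
      ι (m ℕ.+ suc k)       ≡⟨ ≡.cong ι (ℕ.+-suc m k) ⟩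
      ι (suc m ℕ.+ k)       ≈⟨ RP.x∙y⁻¹≈ε⇒x≈y _ _ e ⟨
      ι m                   ∎))
    where open SetoidReasoning R.setoid

  scaleBy : (ℕ → R.Carrier) → Poly → Poly
  scaleBy w []      = []
  scaleBy w (a ∷ p) = w 0 R.* a ∷ scaleBy (w ∘ suc) p

  coeff-scaleBy : ∀ w p n → coeff (scaleBy w p) n R.≈ w n R.* coeff p n
  coeff-scaleBy w []      n       = R.sym (R.zeroʳ _)
  coeff-scaleBy w (a ∷ p) zero    = R.refl
  coeff-scaleBy w (a ∷ p) (suc n) = coeff-scaleBy (w ∘ suc) p n

  -- The operator x d/dx − e.
  θ : ℕ → Poly → Poly
  θ e = scaleBy λ n → ι n R.- ι e

  θ-diagonal : ∀ e → IsDiagonal (λ n → ι n R.- ι e) (θ e)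
  θ-diagonal e = diagonal (coeff-scaleBy _)

  -- The shift by e can be charged to either factor; charging it to q leaves the derivation x d/dx
  -- on p.
  θ-leibniz : ∀ e p q → θ e (p ⊛ q) ≃ θ 0 p ⊛ q ⊕ p ⊛ θ e q
  θ-leibniz e p q .at n = begin
    coeff (θ e (p ⊛ q)) n
      ≈⟨ coeff-scaleBy _ (p ⊛ q) n ⟩
    (ι n R.- ι e) R.* coeff (p ⊛ q) n
      ≈⟨ R.*-congˡ (coeff-⊛ p q n) ⟩
    (ι n R.- ι e) R.* conv (coeff p) (coeff q) n
      ≈⟨ conv-leibniz (λ i → ι i R.- ι 0) (λ j → ι j R.- ι e) (λ n → ι n R.- ι e) weights (coeff p) (coeff q) n ⟩
    conv (λ i → (ι i R.- ι 0) R.* coeff p i) (coeff q) n R.+ conv (coeff p) (λ j → (ι j R.- ι e) R.* coeff q j) n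
      ≈⟨ R.+-cong (conv-cong {g = coeff q} (coeff-scaleBy _ p) (λ _ → R.refl) n)
                  (conv-cong {coeff p} (λ _ → R.refl) (coeff-scaleBy _ q) n) ⟨
    conv (coeff (θ 0 p)) (coeff q) n R.+ conv (coeff p) (coeff (θ e q)) n
      ≈⟨ R.+-cong (coeff-⊛ (θ 0 p) q n) (coeff-⊛ p (θ e q) n) ⟨
    coeff (θ 0 p ⊛ q) n R.+ coeff (p ⊛ θ e q) n
      ≈⟨ coeff-⊕ (θ 0 p ⊛ q) (p ⊛ θ e q) n ⟨
    coeff (θ 0 p ⊛ q ⊕ p ⊛ θ e q) n ∎
    where
    open SetoidReasoning R.setoid
    weights : ∀ i j → ι (i ℕ.+ j) R.- ι e R.≈ (ι i R.- ι 0) R.+ (ι j R.- ι e)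
    weights i j = R.trans (R.+-congʳ (×-homo-+ R.1# i j)) (R.trans (R.+-assoc _ _ _)
      (R.+-congʳ (R.sym (R.trans (R.+-congˡ RP.-0#≈0#) (R.+-identityʳ _)))))

  open SemiringDivisibility P.semiring
  open CommutativeSemigroupDivisibility P.*-commutativeSemigroup using (x∣y⇒zx∣zy; ∙-cong-∣)
  open RingLemmas polynomialRing

  -- One application costs one factor p, whatever e is. In the product rule for p times the rest,
  -- the first term keeps the whole remaining power, and in the second the factor p makes up for the
  -- one lost by induction.
  θ-∣ : ∀ {p f} e k → p ^ suc k ∣ f → p ^ k ∣ θ e f
  θ-∣ {p} {f} e k (h , h⊛p^≃f) = ∣ʳ-respʳ-≈
    (IsLinear.congruent θ-linear (P.trans (P.*-comm (p ^ suc k) h) h⊛p^≃f)) (power k h)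
    where
    θ-linear = diagonal-linear (θ-diagonal e)
    power : ∀ k h → p ^ k ∣ θ e (p ^ suc k ⊛ h)
    power zero    h = 1∣ _
    power (suc k) h = ∣ʳ-respʳ-≈
      (P.sym (P.trans (IsLinear.congruent θ-linear (P.*-assoc p (p ^ suc k) h)) (θ-leibniz e p (p ^ suc k ⊛ h))))
      (∣-+ (x∣ʳy⇒x∣ʳzy (θ 0 p) (h , P.*-comm h (p ^ suc k))) (x∣y⇒zx∣zy p (power k h)))

  -- The first of the n rows is L itself, so the last one carries n - 1 factors `θ`; hence r + 1
  -- columns cost only r powers of p.
  rows : ∀ {n} → (Poly → Poly) → Vec ℕ n → Vec (Poly → Poly) n
  rows L []       = []
  rows L (e ∷ es) = L ∷ rows (θ e ∘ L) es

  θ∘-diagonal : ∀ {w L} e → IsDiagonal w L → IsDiagonal (λ n → (ι n R.- ι e) R.* w n) (θ e ∘ L)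
  θ∘-diagonal {L = L} e diag .coeff-scaled p n = R.trans (coeff-scaled (θ-diagonal e) (L p) n)
    (R.trans (R.*-congˡ (coeff-scaled diag p n)) (R.sym (R.*-assoc _ _ _)))

  rows-linear : ∀ {n w L} (es : Vec ℕ n) → IsDiagonal w L → All IsLinear (rows L es)
  rows-linear []       diag = []
  rows-linear (e ∷ es) diag = diagonal-linear diag ∷ rows-linear es (θ∘-diagonal e diag)

  rows-bound : ∀ {n a L} {Pre : Poly → ℤ → Set a} (es : Vec ℕ n) →
    (∀ {p b} → Pre p b → L p hasBound b) →
    All (λ L → ∀ {p b} → Pre p b → L p hasBound b) (rows L es)
  rows-bound []       h = []
  rows-bound (e ∷ es) h = h ∷ rows-bound es λ pre → diagonal-bound (θ-diagonal e) (h pre)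

  ^-mono : ∀ p s n → p ^ s ∣ p ^ (n ℕ.+ s)
  ^-mono p s zero    = ∣ʳ-refl
  ^-mono p s (suc n) = x∣ʳy⇒x∣ʳzy p (^-mono p s n)

  rows-divisible : ∀ {n L p f} s (es : Vec ℕ (suc n)) → p ^ (n ℕ.+ s) ∣ L f →
    All (λ L → p ^ s ∣ L f) (rows L es)
  rows-divisible {zero} s (e ∷ []) d = d ∷ []
  rows-divisible {suc n} {p = p} s (e ∷ es@(_ ∷ _)) d =
    ∣ʳ-trans (^-mono p s (suc n)) d ∷ rows-divisible s es (θ-∣ {p} e (n ℕ.+ s) d)

  module DegreeBounds {a} (Pre : Poly → ℤ → Set a) =
    Bounds ℤ.+-0-commutativeMonoid _hasBound_ bound-resp bound-one bound-- bound-* Pre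

  -- W(f₁,…,fₙ) with rows adapted to es in place of iterated derivatives: on a
  -- family whose i-th member has degree eᵢ the top coefficients form a triangular matrix.
  wronskian : ∀ {n} → Vec ℕ n → Form n
  wronskian es = det (rows id es)

  id-diagonal : IsDiagonal (λ _ → R.1#) id
  id-diagonal = diagonal λ p n → R.sym (R.*-identityˡ _)

  wronskian-alternating : ∀ {n} (es : Vec ℕ n) → IsAlternating (wronskian es)
  wronskian-alternating es = det-alternating (rows-linear es id-diagonal)

  sumℤ : ∀ {n} → Vec ℤ n → ℤ
  sumℤ = Vec.foldr′ ℤ._+_ ℤ.0ℤ

  sumℤ-+ : ∀ {n} (es : Vec ℕ n) → sumℤ (Vec.map +_ es) ≡ + Vec.sum es
  sumℤ-+ []       = ≡.refl
  sumℤ-+ (e ∷ es) = ≡.cong (ℤ._+_ (+ e)) (sumℤ-+ es)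

  wronskian-bound : ∀ {n} (es : Vec ℕ n) {fs} {ds : Vec ℕ n} → Pointwise HasDegree fs ds →
    wronskian es fs hasBound (+ Vec.sum ds)
  wronskian-bound es {fs} {ds} h =
    bound-resp (≡.trans (ℤ.+-identityˡ _) (sumℤ-+ ds))
      (det-bounded (rows-bound es id) (bounds h))
    where
    open DegreeBounds _hasBound_
    bounds : ∀ {n} {fs : Vec Poly n} {ds : Vec ℕ n} → Pointwise HasDegree fs ds → Pointwise _hasBound_ fs (Vec.map +_ ds)
    bounds []       = []
    bounds (h ∷ hs) = degree⇒bound h ∷ bounds hs

  wronskian-divisible : ∀ {n} (es : Vec ℕ n) {fs qs} →
    Pointwise (λ f q → All (λ L → q ∣ L f) (rows id es)) fs qs →
    Vec.foldr′ _⊛_ (constant R.1#) qs ∣ wronskian es fs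
  wronskian-divisible es h = ∣ʳ-respˡ-≈ (P.*-identityˡ _) (det-bounded (uncurried (rows id es)) h)
    where
    Pre : Poly → Poly → Set _
    Pre f q = All (λ L → q ∣ L f) (rows id es)
    open Bounds P.*-commutativeMonoid (λ x q → q ∣ x) ∣ʳ-respˡ-≈ ∣ʳ-refl ∣-- ∙-cong-∣ Pre
    -- The condition on a column speaks of all rows at once; each row has to project out its own
    -- share.
    uncurried : ∀ {m} (Ls : Vec (Poly → Poly) m) →
      All (λ L → ∀ {f q} → All (λ L → q ∣ L f) Ls → q ∣ L f) Ls
    uncurried []       = []
    uncurried (L ∷ Ls) = (λ { (d ∷ ds) → d }) ∷ All.map (λ k {f} {q} → λ { (d ∷ ds) → k {f} {q} ds }) (uncurried Ls)

  -- The degree of the head bounds the tail. This strict decrease keeps the weights of a row nonzero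
  -- at all the degrees still to come.
  data Echelon (E : ℕ) : ∀ {n} → Vec ℕ n → Vec Poly n → Set (c ⊔ ℓ) where
    []    : Echelon E [] []
    step  : ∀ {n e p} {es : Vec ℕ n} {ps} → e ℕ.< E → HasDegree p e → Echelon e es ps →
            Echelon E (e ∷ es) (p ∷ ps)

  echelon-degrees : ∀ {E n} {es : Vec ℕ n} {ps} → Echelon E es ps → Pointwise _hasBound_ ps (Vec.map +_ es)
  echelon-degrees []              = []
  echelon-degrees (step e<E h hs) = degree⇒bound h ∷ echelon-degrees hs

  -- Only the diagonal term of the determinant reaches degree e₁ + ⋯ + eₙ: all
  -- rows below the first lower the degree of its leading entry.
  det-rows-top : ∀ {E n w L} {es : Vec ℕ n} {ps} → IsDiagonal w L → (∀ i → i ℕ.< E → ¬ (w i R.≈ R.0#)) →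
    Echelon E es ps → ¬ (coeff (det (rows L es) ps) (Vec.sum es) R.≈ R.0#)
  det-rows-top diag w≉0 [] = 1≉0
  det-rows-top {L = L} diag w≉0 (step {p = p} e<E h []) z = leading (degree-* Lp degree-one) z
    where
    Lp : HasDegree (L p) _
    Lp = degree (λ z → *-nonzero (w≉0 _ e<E) (leading h) (R.trans (R.sym (coeff-scaled diag p _)) z))
      λ n e<n → beyond (diagonal-bound diag (degree⇒bound h)) n (ℤ.+<+ e<n)
  det-rows-top {w = w} {L = L} {es = e ∷ es@(_ ∷ _)} {p ∷ ps} diag w≉0 (step e<E h hs@(step _ _ _)) z =
    *-nonzero Lp-leading (det-rows-top (θ∘-diagonal e diag) weight≉0 hs) (begin
      coeff (L p) e R.* coeff (A ps) Σ
        ≈⟨ coeff-top (L p) (A ps) e Σ (λ n e<n → beyond (diagonal-bound diag (degree⇒bound h)) n (ℤ.+<+ e<n))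
             (λ n Σ<n → beyond A-bound n (ℤ.+<+ Σ<n)) ⟨
      coeff (L p ⊛ A ps) (e ℕ.+ Σ)
        ≈⟨ R.+-identityʳ _ ⟨
      coeff (L p ⊛ A ps) (e ℕ.+ Σ) R.+ R.0#
        ≈⟨ R.+-congˡ (R.trans (R.-‿cong rest≈0) RP.-0#≈0#) ⟨
      coeff (L p ⊛ A ps) (e ℕ.+ Σ) R.+ R.- coeff rest (e ℕ.+ Σ)
        ≈⟨ R.+-congˡ (coeff-⊖ rest _) ⟨
      coeff (L p ⊛ A ps) (e ℕ.+ Σ) R.+ coeff (⊖ rest) (e ℕ.+ Σ)
        ≈⟨ coeff-⊕ (L p ⊛ A ps) (⊖ rest) _ ⟨
      coeff (L p ⊛ A ps ⊕ (⊖ rest)) (e ℕ.+ Σ)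
        ≈⟨ z ⟩
      R.0# ∎)
    where
    open SetoidReasoning R.setoid
    Σ = Vec.sum es
    A = det (rows (θ e ∘ L) es)
    rest = wedge L (λ ys → A (p ∷ ys)) ps
    degrees = echelon-degrees hs
    Lp-leading : ¬ (coeff (L p) e R.≈ R.0#)
    Lp-leading z = *-nonzero (w≉0 _ e<E) (leading h) (R.trans (R.sym (coeff-scaled diag p _)) z)
    weight≉0 : ∀ i → i ℕ.< e → ¬ ((ι i R.- ι e) R.* w i R.≈ R.0#)
    weight≉0 i i<e = *-nonzero (ι-distinct i<e) (w≉0 i (ℕ.<-trans i<e e<E))
    A-bound : A ps hasBound (+ Σ)
    A-bound = bound-resp (≡.trans (ℤ.+-identityˡ _) (sumℤ-+ es))
      (det-bounded (rows-bound es (diagonal-bound (θ∘-diagonal e diag))) degrees)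
      where open DegreeBounds _hasBound_
    -- The columns are measured after applying `θ e ∘ L`, not before. Only then may p enter with e -
    -- 1: the weight ι e - ι e kills its coefficient at e, and the rows further down cannot restore
    -- it.
    Pre : Poly → ℤ → Set _
    Pre q b = (θ e ∘ L) q hasBound b
    p-drops : Pre p (ℤ.pred (+ e))
    p-drops .beyond n e-1<n with ℕ.m≤n⇒m<n∨m≡n (ℤ.drop‿+≤+ (≡.subst (ℤ._≤ + n) (ℤ.suc-pred (+ e)) (ℤ.i<j⇒suc[i]≤j e-1<n)))
    ... | inj₁ e<n    = beyond (diagonal-bound (θ∘-diagonal e diag) (degree⇒bound h)) n (ℤ.+<+ e<n)
    ... | inj₂ ≡.refl = R.trans (coeff-scaled (θ∘-diagonal e diag) p e)
      (R.trans (R.*-congʳ (R.trans (R.*-congʳ (R.-‿inverseʳ _)) (R.zeroˡ _))) (R.zeroˡ _))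
    rest-bound : rest hasBound (ℤ.pred (+ e) ℤ.+ sumℤ (Vec.map +_ es))
    rest-bound = wedge-bounded {d = ℤ.pred (+ e)} {A = λ ys → A (p ∷ ys)} (diagonal-bound diag)
      (λ qs → bound-resp (ℤ.+-identityˡ _)
        (D.det-bounded (rows-bound es id)
          (p-drops ∷ Pointwise.map (diagonal-bound (θ∘-diagonal e diag)) qs))) degrees
      where
      open DegreeBounds _hasBound_
      module D = DegreeBounds Pre
    rest≈0 : coeff rest (e ℕ.+ Σ) R.≈ R.0#
    rest≈0 = beyond rest-bound (e ℕ.+ Σ) (≡.subst (λ s → ℤ.pred (+ e) ℤ.+ s ℤ.< + (e ℕ.+ Σ)) (≡.sym (sumℤ-+ es))
      (ℤ.+-monoˡ-< (+ Σ) (ℤ.suc[i]≤j⇒i<j {ℤ.pred (+ e)} (ℤ.≤-reflexive (ℤ.suc-pred (+ e))))))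

-- Gaussian elimination by degree

lookup-removeAt : ∀ {a} {A : Set a} {n} (xs : Vec A (suc n)) i j →
  lookup (Vec.removeAt xs i) j ≡ lookup xs (punchIn i j)
lookup-removeAt (x ∷ xs)         zero    j       = ≡.refl
lookup-removeAt (x ∷ xs@(_ ∷ _)) (suc i) zero    = ≡.refl
lookup-removeAt (x ∷ xs@(_ ∷ _)) (suc i) (suc j) = lookup-removeAt xs i j

module EchelonForm {c ℓ} (R : CommutativeRing c ℓ) (isWeakField : IsWeakField R) where

  open Wronskian R isWeakField public
  open GCD R isWeakField public
  private module RR = RingLemmas polynomialRing

  combination : ∀ {n} → Vec R.Carrier n → Vec Poly n → Poly
  combination []       []       = []
  combination (a ∷ as) (p ∷ ps) = constant a ⊛ p ⊕ combination as ps

  Independent : ∀ {n} → Vec Poly n → Set _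
  Independent ps = ∀ as → combination as ps ≃ [] → ∀ i → lookup as i R.≈ R.0#

  combination-insertAt : ∀ {n} (as : Vec R.Carrier n) i b ps →
    combination (insertAt as i b) ps ≃ constant b ⊛ lookup ps i ⊕ combination as (Vec.removeAt ps i)
  combination-insertAt as       zero    b (p ∷ ps)          = P.refl
  combination-insertAt (a ∷ as) (suc i) b (p ∷ ps@(_ ∷ _)) = P.trans
    (P.+-congˡ {constant a ⊛ p} (combination-insertAt as i b ps))
    (x∙yz≈y∙xz (constant a ⊛ p) (constant b ⊛ lookup ps i) (combination as (Vec.removeAt ps i)))
    where open CommutativeSemigroupProperties P.+-commutativeSemigroup using (x∙yz≈y∙xz)

  addMultiples : ∀ {n} → Poly → (Poly → R.Carrier) → Vec Poly n → Vec Poly n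
  addMultiples x t = Vec.map λ y → y ⊕ constant (t y) ⊛ x

  -- The coefficient of x may stay anonymous: independence is inherited as soon as a relation among
  -- the changed entries is some relation among x and the original ones with the same coefficients
  -- `as`.
  combination-addMultiples : ∀ {n} x t (as : Vec R.Carrier n) ys →
    ∃ λ b → combination as (addMultiples x t ys) ≃ constant b ⊛ x ⊕ combination as ys
  combination-addMultiples x t []       []       =
    R.0# , P.sym (P.trans (P.+-identityʳ _) (P.trans (P.*-congʳ constant-0) (P.zeroˡ x)))
  combination-addMultiples x t (a ∷ as) (y ∷ ys) with combination-addMultiples x t as ys
  ... | b , e = a R.* t y R.+ b , P.trans
    (P.+-congˡ {constant a ⊛ (y ⊕ constant (t y) ⊛ x)} e)
    (P.trans (RR.collect (constant a) y (constant (t y)) x (constant b) (combination as ys))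
      (P.+-congʳ {constant a ⊛ y ⊕ combination as ys}
        (P.*-congʳ {x} (P.+-congʳ {constant b} (P.sym (constant-* a (t y)))))))

  weaken : ∀ {E E′ n} {es : Vec ℕ n} {ps} → E ℕ.≤ E′ → Echelon E es ps → Echelon E′ es ps
  weaken E≤E′ []              = []
  weaken E≤E′ (step e<E h hs) = step (ℕ.<-≤-trans e<E E≤E′) h hs

  -- Agreement is demanded for all alternating forms because the form of interest, the Wronskian for
  -- `es`, is known only once the degrees are.
  Reduct : ∀ {n} → ℕ → Vec Poly n → Set _
  Reduct {n} E ps = ∃₂ λ (es : Vec ℕ n) qs → Echelon E es qs × (∀ A → IsAlternating A → A ps ≈± A qs)

  -- Elimination at the coefficient of x^E. Either it vanishes throughout and the bound drops, or a
  -- pivot goes to the front and clears it from the others; both moves change alternating forms by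
  -- at most a sign.
  echelon-form : ∀ E {n} (ps : Vec Poly n) → (∀ i → lookup ps i <° E) → Independent ps →
    ¬ ¬ Reduct E ps
  echelon-form E [] ps< ind = return ([] , [] , [] , λ A _ → inj₁ P.refl)
  -- Below the bound 0 all entries are zero polynomials, so the relation 1 * p = 0 contradicts
  -- independence.
  echelon-form zero {suc n} (p ∷ ps) ps< ind _ = 1≉0 (ind (insertAt (Vec.replicate n R.0#) zero R.1#)
      (P.+-cong (P.trans (P.*-identityˡ p) (coeffwise λ i → ps< zero i ℕ.z≤n)) (zeros ps)) zero)
    where
    zeros : ∀ {n} (ps : Vec Poly n) → combination (Vec.replicate n R.0#) ps ≃ []
    zeros []       = P.refl
    zeros (p ∷ ps) = P.+-cong (P.trans (P.*-congʳ constant-0) (P.zeroˡ p)) (zeros ps)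
  echelon-form (suc E) {suc n} ps@(_ ∷ _) ps< ind =
    all-or-counterexample (λ i → coeff (lookup ps i) E R.≈ R.0#) (λ _ → stable) >>= λ where
      (inj₁ zeros) → echelon-form E ps (λ i m E≤m → lower {lookup ps i} (ps< i) (zeros i) (ℕ.m≤n⇒m<n∨m≡n E≤m)) ind
        >>= λ (es , qs , hs , agree) → return (es , qs , weaken (ℕ.n≤1+n E) hs , agree)
      (inj₂ (i , pivot≉0)) → inverse pivot≉0 >>= λ (b , xb≈1) → eliminate i pivot≉0 b xb≈1
    where
    lower : ∀ {p m} → p <° suc E → coeff p E R.≈ R.0# → E ℕ.< m ⊎ E ≡ m → coeff p m R.≈ R.0#
    lower p< pE≈0 (inj₁ E<m)    = p< _ E<m
    lower p< pE≈0 (inj₂ ≡.refl) = pE≈0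
    eliminate : ∀ i → ¬ (coeff (lookup ps i) E R.≈ R.0#) → ∀ b → coeff (lookup ps i) E R.* b R.≈ R.1# →
      ¬ ¬ Reduct (suc E) ps
    eliminate i pivot≉0 b xb≈1 = echelon-form E zs zs< zs-independent >>= λ (es , qs , hs , agree) →
      return (E ∷ es , x ∷ qs , step ℕ.≤-refl (degree pivot≉0 (ps< i)) hs , λ A alt →
        ≈±-trans {A ps} (≈±-sym (bring-to-front alt ps i)) (≈±-trans {A (x ∷ ys)}
          (inj₁ (P.sym (add-multiples alt x t ys))) (agree _ (tailAlternating alt x))))
      where
      x  = lookup ps i
      ys = Vec.removeAt ps i
      t : Poly → R.Carrier
      t y = R.- (coeff y E R.* b)
      zs = addMultiples x t ys
      coeff-z : ∀ y m → coeff (y ⊕ constant (t y) ⊛ x) m R.≈ coeff y m R.+ t y R.* coeff x m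
      coeff-z y m = R.trans (coeff-⊕ y (constant (t y) ⊛ x) m)
        (R.+-congˡ (R.trans (at (constant-⊛ (t y) x) m) (coeff-· (t y) x m)))
      z< : ∀ {y} → y <° suc E → (y ⊕ constant (t y) ⊛ x) <° E
      z< {y} y< m E≤m = lower {y ⊕ constant (t y) ⊛ x}
        (λ m E<m → R.trans (coeff-z y m) (R.trans (R.+-cong (y< m E<m)
          (R.trans (R.*-congˡ (ps< i m E<m)) (R.zeroʳ _))) (R.+-identityˡ _)))
        (R.trans (coeff-z y E) (R.trans (R.+-congˡ cancel) (R.-‿inverseʳ _)))
        (ℕ.m≤n⇒m<n∨m≡n E≤m)
        where
        open RingProperties R.ring using (-‿distribˡ-*)
        cancel : t y R.* coeff x E R.≈ R.- coeff y E
        cancel = R.trans (R.sym (-‿distribˡ-* _ _)) (R.-‿cong (R.trans (R.*-assoc _ _ _)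
          (R.trans (R.*-congˡ (R.trans (R.*-comm _ _) xb≈1)) (R.*-identityʳ _))))
      zs< : ∀ j → lookup zs j <° E
      zs< j rewrite Vec.lookup-map j (λ y → y ⊕ constant (t y) ⊛ x) ys
                  | lookup-removeAt ps i j = z< {lookup ps (punchIn i j)} (ps< (punchIn i j))
      zs-independent : Independent zs
      zs-independent as e j with combination-addMultiples x t as ys
      ... | s , f = ≡.subst (R._≈ R.0#) (Vec.insertAt-punchIn as i s j)
        (ind (insertAt as i s) (P.trans (combination-insertAt as i s ps) (P.trans (P.sym f) e)) (punchIn i j))

  common-bound : ∀ {n} (ps : Vec Poly n) → ∃ λ E → ∀ i → lookup ps i <° E
  common-bound []       = 0 , λ ()
  common-bound (p ∷ ps) with common-bound ps
  ... | E , ps< = length p ℕ.⊔ E , λ where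
    zero    m le → bounded-by-length p m (ℕ.m⊔n≤o⇒m≤o _ _ le)
    (suc i) m le → ps< i m (ℕ.m⊔n≤o⇒n≤o (length p) _ le)

  wronskian-nonzero : ∀ {n} (ps : Vec Poly n) → Independent ps → ¬ ¬ ∃ λ es → ¬ (wronskian es ps ≃ [])
  wronskian-nonzero ps ind with common-bound ps
  ... | E , ps< = echelon-form E ps ps< ind >>= λ (es , qs , hs , agree) → return (es , λ W≃0 →
      det-rows-top id-diagonal (λ _ _ → 1≉0) hs (at (vanish (≈±-sym (agree _ (wronskian-alternating es))) W≃0) _))
    where
    vanish : ∀ {p q} → p ≈± q → q ≃ [] → p ≃ []
    vanish (inj₁ e) q≃0 = P.trans e q≃0
    vanish (inj₂ e) q≃0 = P.trans e (P.-‿cong q≃0)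

  -- Strictly decreasing degrees below 1 leave room for a single entry.
  constants-dependent : ∀ {n} (ps : Vec Poly (suc (suc n))) → (∀ i → lookup ps i <° 1) → ¬ Independent ps
  constants-dependent ps ps< ind = echelon-form 1 ps ps< ind λ where
    (_ , _ , step (ℕ.s≤s ℕ.z≤n) _ (step () _ _) , _)

tabulate-removeAt : ∀ {a} {A : Set a} {n} (f : Fin (suc n) → A) i →
  Vec.removeAt (tabulate f) i ≡ tabulate (Vector.removeAt f i)
tabulate-removeAt         f zero    = ≡.refl
tabulate-removeAt {n = suc n} f (suc i) = ≡.cong (f zero ∷_) (tabulate-removeAt (f ∘ suc) i)

-- Double negation shift, constructive because the index set is finite.
∀-¬¬-commute : ∀ {n p} {P : Fin n → Set p} → (∀ i → ¬ ¬ P i) → ¬ ¬ (∀ i → P i)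
∀-¬¬-commute {zero}  h = return λ ()
∀-¬¬-commute {suc n} h = h zero >>= λ p₀ → ∀-¬¬-commute (h ∘ suc) >>= λ p → return λ where
  zero    → p₀
  (suc i) → p i

-- Counting degrees

module DegreeCount where

  open SemiringSum ℕ.+-*-semiring
  open ℕ.≤-Reasoning

  sum-≤ : ∀ {n} (t : Vector ℕ n) {c} → (∀ i → t i ℕ.≤ c) → sum t ℕ.≤ n ℕ.* c
  sum-≤ {zero}  t h = ℕ.z≤n
  sum-≤ {suc n} t h = ℕ.+-mono-≤ (h zero) (sum-≤ (t ∘ suc) (h ∘ suc))

  member-≤-sum : ∀ {n} (t : Vector ℕ n) i → t i ℕ.≤ sum t
  member-≤-sum t zero    = ℕ.m≤m+n _ _
  member-≤-sum t (suc i) = ℕ.≤-trans (member-≤-sum (t ∘ suc) i) (ℕ.m≤n+m _ _)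

  degrees-vanish : ∀ {n} r (k d : Vector ℕ (suc n)) → (∀ i → suc n ℕ.* r ℕ.< k i) →
    (∀ j → sum (λ i → (k i ℕ.∸ r) ℕ.* d i) ℕ.≤ sum (Vector.removeAt (λ i → k i ℕ.* d i) j)) →
    ∀ i → d i ≡ 0
  -- With S = Σ dᵢ, summation over j gives (m r + 1) S ≤ m r S; the left side unfolds to S + m r S,
  -- and cancelling leaves S ≤ 0.
  degrees-vanish {n} r k d k> h i = ℕ.n≤0⇒n≡0 (ℕ.≤-trans (member-≤-sum d i) (ℕ.+-cancelʳ-≤ (m ℕ.* r ℕ.* S) S 0 (begin
      suc (m ℕ.* r) ℕ.* S                      ≡⟨ *-distribˡ-sum (suc (m ℕ.* r)) d ⟩
      sum (λ j → suc (m ℕ.* r) ℕ.* d j)        ≤⟨ sum-≤ _ (λ j → ℕ.≤-trans (ℕ.*-monoˡ-≤ (d j) (k> j)) (kd≤ j)) ⟩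
      m ℕ.* (r ℕ.* S)                          ≡⟨ ℕ.*-assoc m r S ⟨
      m ℕ.* r ℕ.* S                            ∎)))
    where
    m = suc n
    S = sum d
    kd sd : Vector ℕ m
    kd i = k i ℕ.* d i
    sd i = (k i ℕ.∸ r) ℕ.* d i
    kd≡ : ∀ i → kd i ≡ r ℕ.* d i ℕ.+ sd i
    kd≡ i = ≡.trans
      (≡.cong (ℕ._* d i) (≡.sym (ℕ.m+[n∸m]≡n (ℕ.≤-trans (ℕ.m≤n*m r m) (ℕ.<⇒≤ (k> i))))))
      (ℕ.*-distribʳ-+ (d i) r (k i ℕ.∸ r))
    -- Adding kⱼ dⱼ to both sides of `h j` completes the sum on the right; splitting kᵢ = r + (kᵢ -
    -- r) there lets all terms (kᵢ - r) dᵢ cancel.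
    kd≤ : ∀ j → kd j ℕ.≤ r ℕ.* S
    kd≤ j = ℕ.+-cancelʳ-≤ (sum sd) (kd j) (r ℕ.* S) (begin
      kd j ℕ.+ sum sd                          ≤⟨ ℕ.+-monoʳ-≤ (kd j) (h j) ⟩
      kd j ℕ.+ sum (Vector.removeAt kd j)      ≡⟨ sum-remove kd ⟨
      sum kd                                   ≡⟨ sum-cong-≗ kd≡ ⟩
      sum (λ i → r ℕ.* d i ℕ.+ sd i)           ≡⟨ ∑-distrib-+ (λ i → r ℕ.* d i) sd ⟩
      sum (λ i → r ℕ.* d i) ℕ.+ sum sd         ≡⟨ ≡.cong (ℕ._+ sum sd) (*-distribˡ-sum r d) ⟨
      r ℕ.* S ℕ.+ sum sd                       ∎)

-- The vanishing sum of powers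

module FermatEquation {c ℓ} (R : CommutativeRing c ℓ) (isWeakField : IsWeakField R) where

  open EchelonForm R isWeakField
  open Polynomials R.rawRing using (_^_; sum; JointlyCoprime; LinearlyIndependent)
  open SemiringDivisibility P.semiring
  open CommutativeSemigroupDivisibility P.*-commutativeSemigroup using (x∣y⇒zx∣zy)
  open DegreeCount
  private
    module Σℕ = SemiringSum ℕ.+-*-semiring
    module Π = MonoidSum P.*-commutativeMonoid

  independent-tabulate : ∀ {n} (v : Vector Poly n) → LinearlyIndependent v → Independent (tabulate v)
  independent-tabulate v li as e = li (lookup as) (at (P.trans (P.sym (expand as v)) e))
    where
    expand : ∀ {n} as (v : Vector Poly n) → combination as (tabulate v) ≃ sum (λ i → lookup as i · v i)
    expand []       v = P.refl
    expand (a ∷ as) v = P.+-cong (constant-⊛ a (v zero)) (expand as (v ∘ suc))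

  total-tabulate : ∀ {n} (v : Vector Poly n) → total (tabulate v) ≡ sum v
  total-tabulate {zero}  v = ≡.refl
  total-tabulate {suc n} v = ≡.cong (v zero ⊕_) (total-tabulate (v ∘ suc))

  product-tabulate : ∀ {n} (v : Vector Poly n) → Vec.foldr′ _⊛_ (constant R.1#) (tabulate v) ≡ Π.sum v
  product-tabulate {zero}  v = ≡.refl
  product-tabulate {suc n} v = ≡.cong (v zero ⊛_) (product-tabulate (v ∘ suc))

  sum-tabulate : ∀ {n} (v : Vector ℕ n) → Vec.sum (tabulate v) ≡ Σℕ.sum v
  sum-tabulate {zero}  v = ≡.refl
  sum-tabulate {suc n} v = ≡.cong (v zero ℕ.+_) (sum-tabulate (v ∘ suc))

  degree-product : ∀ {n} {v : Vector Poly n} {d} → (∀ i → HasDegree (v i) (d i)) → HasDegree (Π.sum v) (Σℕ.sum d)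
  degree-product {zero}  h = degree-one
  degree-product {suc n} h = degree-* (h zero) (degree-product (h ∘ suc))

  ∣-± : ∀ {a b d} → a ≈± b → d ∣ a → d ∣ b
  ∣-± (inj₁ e) x∣a = ∣ʳ-respʳ-≈ e x∣a
  ∣-± {b = b} (inj₂ e) (q , f) = (⊖ q) , P.trans (P.sym (-‿distribˡ-* q _))
    (P.trans (P.-‿cong (P.trans f e)) (-‿involutive b))
    where open RingProperties P.ring

  -- Here m = r + 2: omitting an index leaves r + 1 columns and rows of order 0 to r. The condition
  -- r ≤ kᵢ makes `k i ∸ r` a genuine difference.
  module _ {r : ℕ} (p : Vector Poly (2 ℕ.+ r)) (k d : Vector ℕ (2 ℕ.+ r))
    (deg : ∀ i → HasDegree (p i) (d i)) (r≤k : ∀ i → r ℕ.≤ k i)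
    (coprime : JointlyCoprime (λ i → p i ^ k i))
    (Σ≈0 : sum (λ i → p i ^ k i) ≋ [])
    (independent : ∀ j → LinearlyIndependent (Vector.removeAt (λ i → p i ^ k i) j))
    where

    private
      f q : Vector Poly (2 ℕ.+ r)
      f i = p i ^ k i
      q i = p i ^ (k i ℕ.∸ r)

      omit : ∀ {a} {A : Set a} → Vector A (2 ℕ.+ r) → Fin (2 ℕ.+ r) → Vec A (suc r)
      omit v j = tabulate (Vector.removeAt v j)

      Q : Poly
      Q = Π.sum q

    omitted-agree : ∀ es i j → wronskian es (omit f i) ≈± wronskian es (omit f j)
    omitted-agree es i j = ≈±-trans {wronskian es (omit f i)} (agree i) (≈±-sym (agree j))
      where
      agree : ∀ j → wronskian es (omit f j) ≈± wronskian es (omit f zero)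
      agree j = ≡.subst (λ v → wronskian es v ≈± wronskian es (omit f zero)) (tabulate-removeAt f j)
        (omit-agree (wronskian-alternating es) (tabulate f)
          (coeffwise (≡.subst (_≋ []) (≡.sym (total-tabulate f)) Σ≈0)) j)

    omitted-product-divides : ∀ es i → Π.sum (Vector.removeAt q i) ∣ wronskian es (omit f i)
    omitted-product-divides es i = ≡.subst (_∣ wronskian es (omit f i)) (product-tabulate (Vector.removeAt q i))
      (wronskian-divisible es (Pointwise.tabulate⁺ λ j → rows-divisible (k (punchIn i j) ℕ.∸ r) es
        (∣ʳ-reflexive (P.reflexive (≡.cong (p (punchIn i j) ^_) (ℕ.m+[n∸m]≡n (r≤k (punchIn i j))))))))

    product-divides : ∀ es j i → Q ∣ q i ⊛ wronskian es (omit f j)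
    product-divides es j i = ∣ʳ-respˡ-≈ (P.sym (Π.sum-remove {i = i} q))
      (x∣y⇒zx∣zy (q i) (∣-± (omitted-agree es i j) (omitted-product-divides es i)))

    -- A common divisor of the qᵢ divides the powers pᵢ^kᵢ and is therefore constant; it is not zero
    -- since it divides q₀. Normalising it to 1 would gain nothing, as degree 0 does not disturb the
    -- count.
    coprime-multiplier : ¬ ¬ ∃ λ e → HasDegree e 0 × InIdeal e (tabulate q)
    coprime-multiplier = gcd-exists (tabulate q) >>= λ (e , e∣ , ideal) →
      let e∣q : ∀ i → e ∣ q i
          e∣q i = ≡.subst (e ∣_) (Vec.lookup∘tabulate q i) (e∣ i)
          e-constant = coprime e λ i → convert (∣ʳ-trans (e∣q i) (q∣f i))
          e≉0 : ¬ (coeff e 0 R.≈ R.0#)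
          e≉0 e₀≈0 = degree-nonzero (degree-^ (k zero ℕ.∸ r) (deg zero))
            (0∣x⇒x≈0 (∣ʳ-respˡ-≈ (coeffwise λ { zero → e₀≈0 ; (suc n) → e-constant n }) (e∣q zero)))
      in return (e , degree e≉0 (λ { (suc n) _ → e-constant n }) , ideal)
      where
      q∣f : ∀ i → q i ∣ f i
      q∣f i = ≡.subst (λ n → q i ∣ p i ^ n) (ℕ.m+[n∸m]≡n (r≤k i)) (^-mono (p i) (k i ℕ.∸ r) r)
      convert : ∀ {x y} → x ∣ y → Polynomials._∣_ R.rawRing x y
      convert (z , e) = record { quotient = z ; equality = at e }

    degree-inequality : ∀ j →
      Σℕ.sum (λ i → (k i ℕ.∸ r) ℕ.* d i) ℕ.≤ Σℕ.sum (Vector.removeAt (λ i → k i ℕ.* d i) j)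
    degree-inequality j = decidable-stable (_ ℕ.≤? _) (
      wronskian-nonzero (omit f j) (independent-tabulate (Vector.removeAt f j) (independent j)) >>= λ (es , W≄0) →
      degree-exists (wronskian es (omit f j)) W≄0 >>= λ (w , degW) →
      coprime-multiplier >>= λ (e , deg-e , ideal) →
      let W      = wronskian es (omit f j)
          deg-eW = degree-* deg-e degW
          -- Ideal membership of e tested at the divisor Q and the multiplier W: Q divides every qᵢ
          -- W, hence e W.
          x , xQ≃eW = ideal Q W λ i → ≡.subst (λ y → Q ∣ y ⊛ W) (≡.sym (Vec.lookup∘tabulate q i)) (product-divides es j i)
      in degree-exists x (λ x≃0 → degree-nonzero deg-eW
           (P.trans (P.sym xQ≃eW) (P.trans (P.*-congʳ x≃0) (P.zeroˡ Q)))) >>= λ (t , deg-x) →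
      return (begin
        Σℕ.sum (λ i → (k i ℕ.∸ r) ℕ.* d i)
          ≤⟨ ℕ.m≤n+m _ t ⟩
        t ℕ.+ Σℕ.sum (λ i → (k i ℕ.∸ r) ℕ.* d i)
          ≡⟨ degree-unique (degree-resp xQ≃eW (degree-* deg-x
               (degree-product (λ i → degree-^ (k i ℕ.∸ r) (deg i))))) deg-eW ⟩
        w
          ≤⟨ bound⇒degree-≤ degW (wronskian-bound es
               (Pointwise.tabulate⁺ λ i → degree-^ (k (punchIn j i)) (deg (punchIn j i)))) ⟩
        Vec.sum (omit (λ i → k i ℕ.* d i) j)
          ≡⟨ sum-tabulate (Vector.removeAt (λ i → k i ℕ.* d i) j) ⟩
        Σℕ.sum (Vector.removeAt (λ i → k i ℕ.* d i) j) ∎))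
      where open ℕ.≤-Reasoning

  -- Here m = r + 3, so that m - 2 is `suc r`. Once all degrees vanish, the powers are constants,
  -- and at least two of them remain after omitting one, which cannot be independent; this needs m ≥
  -- 3.
  no-large-exponents : ∀ {r} (p : Vector Poly (3 ℕ.+ r)) → (∀ i → ¬ (p i ≋ [])) → (k : Vector ℕ (3 ℕ.+ r)) →
    JointlyCoprime (λ i → p i ^ k i) → sum (λ i → p i ^ k i) ≋ [] →
    (∀ j → LinearlyIndependent (Vector.removeAt (λ i → p i ^ k i) j)) →
    ¬ (∀ i → (3 ℕ.+ r) ℕ.* suc r ℕ.< k i)
  no-large-exponents {r} p p≉0 k coprime Σ≈0 independent k> =
    ∀-¬¬-commute (λ i → degree-exists (p i) (p≉0 i ∘ at)) λ h →
      let d   = proj₁ ∘ h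
          deg = proj₂ ∘ h
          d≡0 = degrees-vanish (suc r) k d k> (degree-inequality p k d deg
                  (λ i → ℕ.≤-trans (ℕ.m≤n*m (suc r) (3 ℕ.+ r)) (ℕ.<⇒≤ (k> i))) coprime Σ≈0 independent)
          f   = Vector.removeAt (λ i → p i ^ k i) zero
      in constants-dependent (tabulate f)
           (λ i → ≡.subst (_<° 1) (≡.sym (Vec.lookup∘tabulate f i))
             (above (≡.subst (HasDegree (f i)) (≡.trans (≡.cong (k (suc i) ℕ.*_) (d≡0 (suc i))) (ℕ.*-zeroʳ (k (suc i))))
               (degree-^ (k (suc i)) (deg (suc i))))))
           (independent-tabulate f (independent zero))

-- Rational estimates and the reals

module RationalLemmas where

  open import Data.Rational.Base using (_<_; _≤_; _+_; _*_; _-_; -_; ∣_∣; 1/_; ≢-nonZero; positive; Positive; NonZero)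
  open ℚ.≤-Reasoning

  abstract
    <⇒≱ : ∀ {p q} → p < q → ¬ (q ≤ p)
    <⇒≱ p<q q≤p = ℚ.<-irrefl ≡.refl (ℚ.<-≤-trans p<q q≤p)

    *-pos : ∀ {p q} → 0ℚ < p → 0ℚ < q → 0ℚ < p * q
    *-pos {p} {q} 0<p 0<q = ℚ.positive⁻¹ (p * q)
      {{ℚ.pos*pos⇒pos p {{positive 0<p}} q {{positive 0<q}}}}

    recip : ∀ {p} → 0ℚ < p → ∃ λ q → 0ℚ < q × q * p ≡ 1ℚ
    recip {p} 0<p = 1/ p , ℚ.positive⁻¹ (1/ p) {{ℚ.1/pos⇒pos p}} , ℚ.*-inverseˡ p
      where
      instance
        p-positive : Positive p
        p-positive = positive 0<p
        p-nonZero : NonZero p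
        p-nonZero = ℚ.pos⇒nonZero p

    square-nonNeg : ∀ p → 0ℚ ≤ p * p
    square-nonNeg p = begin
      0ℚ              ≡⟨ ℚ.*-zeroˡ ∣ p ∣ ⟨
      0ℚ * ∣ p ∣      ≤⟨ ℚ.*-monoʳ-≤-nonNeg ∣ p ∣ {{ℚ.∣-∣-nonNeg p}} (ℚ.0≤∣p∣ p) ⟩
      ∣ p ∣ * ∣ p ∣   ≡⟨ square (ℚ.∣p∣≡p∨∣p∣≡-p p) ⟩
      p * p           ∎
      where
      square : ∣ p ∣ ≡ p ⊎ ∣ p ∣ ≡ - p → ∣ p ∣ * ∣ p ∣ ≡ p * p
      square (inj₁ e) = ≡.cong₂ _*_ e e
      square (inj₂ e) = ≡.trans (≡.cong₂ _*_ e e) (solve 1 (λ p → :- p :* :- p := p :* p) ≡.refl p)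
        where open +-*-Solver

    p≤∣p∣ : ∀ p → p ≤ ∣ p ∣
    p≤∣p∣ p = helper (ℚ.≤-total 0ℚ p)
      where
      helper : 0ℚ ≤ p ⊎ p ≤ 0ℚ → p ≤ ∣ p ∣
      helper (inj₁ 0≤p) = ℚ.≤-reflexive (≡.sym (ℚ.0≤p⇒∣p∣≡p 0≤p))
      helper (inj₂ p≤0) = ℚ.≤-trans p≤0 (ℚ.0≤∣p∣ p)

    ∣p∣≤∣p-q∣+∣q∣ : ∀ p q → ∣ p ∣ ≤ ∣ p - q ∣ + ∣ q ∣
    ∣p∣≤∣p-q∣+∣q∣ p q = ≡.subst (λ z → ∣ z ∣ ≤ ∣ p - q ∣ + ∣ q ∣)
      (solve 2 (λ a b → (a :- b) :+ b := a) ≡.refl p q) (ℚ.∣p+q∣≤∣p∣+∣q∣ (p - q) q)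
      where open +-*-Solver

    ∣p*q∣< : ∀ p q {B δ} → 0ℚ < B → ∣ p ∣ < δ → ∣ q ∣ ≤ B → ∣ p * q ∣ < δ * B
    ∣p*q∣< p q {B} {δ} 0<B p<δ q≤B = begin-strict
      ∣ p * q ∣       ≡⟨ ℚ.∣p*q∣≡∣p∣*∣q∣ p q ⟩
      ∣ p ∣ * ∣ q ∣   ≤⟨ ℚ.*-monoˡ-≤-nonNeg ∣ p ∣ {{ℚ.∣-∣-nonNeg p}} q≤B ⟩
      ∣ p ∣ * B       <⟨ ℚ.*-monoˡ-<-pos B {{positive 0<B}} p<δ ⟩
      δ * B           ∎

    -- Junk value 0 at 0.
    inv : ℚ → ℚ
    inv p with p ℚ.≟ 0ℚ
    ... | yes _   = 0ℚ
    ... | no  p≢0 = 1/_ p {{≢-nonZero p≢0}}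

    inv-inverse : ∀ p → p ≢ 0ℚ → p * inv p ≡ 1ℚ
    inv-inverse p p≢0 with p ℚ.≟ 0ℚ
    ... | yes p≡0  = contradiction p≡0 p≢0
    ... | no  p≢0′ = ℚ.*-inverseʳ p {{≢-nonZero p≢0′}}

    away-from-zero : ∀ {p δ} → 0ℚ < δ → δ ≤ ∣ p ∣ → p ≢ 0ℚ
    away-from-zero 0<δ δ≤∣p∣ ≡.refl = <⇒≱ 0<δ δ≤∣p∣

    inv-bound : ∀ {p δ C} → 0ℚ < δ → C * δ ≡ 1ℚ → 0ℚ < C → δ ≤ ∣ p ∣ → ∣ inv p ∣ ≤ C
    inv-bound {p} {δ} {C} 0<δ Cδ≡1 0<C δ≤∣p∣ = begin
      ∣ inv p ∣                     ≡⟨ ℚ.*-identityˡ _ ⟨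
      1ℚ * ∣ inv p ∣                ≡⟨ ≡.cong (_* ∣ inv p ∣) Cδ≡1 ⟨
      C * δ * ∣ inv p ∣             ≡⟨ ℚ.*-assoc C δ _ ⟩
      C * (δ * ∣ inv p ∣)           ≤⟨ ℚ.*-monoˡ-≤-nonNeg C {{ℚ.pos⇒nonNeg C {{positive 0<C}}}}
                                         (ℚ.*-monoʳ-≤-nonNeg ∣ inv p ∣ {{ℚ.∣-∣-nonNeg (inv p)}} δ≤∣p∣) ⟩
      C * (∣ p ∣ * ∣ inv p ∣)       ≡⟨ ≡.cong (C *_) (ℚ.∣p*q∣≡∣p∣*∣q∣ p (inv p)) ⟨
      C * ∣ p * inv p ∣             ≡⟨ ≡.cong (λ z → C * ∣ z ∣) (inv-inverse p (away-from-zero 0<δ δ≤∣p∣)) ⟩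
      C * 1ℚ                        ≡⟨ ℚ.*-identityʳ C ⟩
      C                             ∎

    inv-difference : ∀ p q → p ≢ 0ℚ → q ≢ 0ℚ → inv p - inv q ≡ (q - p) * (inv p * inv q)
    inv-difference p q p≢0 q≢0 = begin-equality
      inv p - inv q
        ≡⟨ ≡.cong₂ _-_ (ℚ.*-identityʳ (inv p)) (ℚ.*-identityʳ (inv q)) ⟨
      inv p * 1ℚ - inv q * 1ℚ
        ≡⟨ ≡.cong₂ (λ a b → inv p * a - inv q * b) (inv-inverse q q≢0) (inv-inverse p p≢0) ⟨
      inv p * (q * inv q) - inv q * (p * inv p)
        ≡⟨ solve 4 (λ p q a b → a :* (q :* b) :- b :* (p :* a) := (q :- p) :* (a :* b)) ≡.refl p q (inv p) (inv q) ⟩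
      (q - p) * (inv p * inv q) ∎
      where open +-*-Solver

module RealNumbers where

  open import Data.Rational.Base using (_<_; _≤_; _+_; _*_; _-_; ∣_∣; ½)
  open RationalLemmas

  -- `x ≈ℝ y` unfolds to `Null` of the difference sequence, so congruence laws become closure
  -- properties of null sequences plus an identity over ℚ.
  Null : (ℕ → ℚ) → Set
  Null z = ∀ ε → 0ℚ < ε → ∃ λ N → ∀ n → N ℕ.≤ n → ∣ z n ∣ < ε

  null-cong : ∀ {y z} → (∀ n → y n ≡ z n) → Null y → Null z
  null-cong y≡z y→0 ε 0<ε with y→0 ε 0<ε
  ... | N , h = N , λ n N≤n → ≡.subst (λ q → ∣ q ∣ < ε) (y≡z n) (h n N≤n)

  half-positive : ∀ {ε} → 0ℚ < ε → 0ℚ < ½ * ε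
  half-positive = *-pos (ℚ.positive⁻¹ ½)

  two-halves : ∀ ε → ½ * ε + ½ * ε ≡ ε
  two-halves = solve 1 (λ e → con ½ :* e :+ con ½ :* e := e) ≡.refl
    where open +-*-Solver

  null-+ : ∀ {y z} → Null y → Null z → Null (λ n → y n + z n)
  null-+ {y} {z} y→0 z→0 ε 0<ε with y→0 (½ * ε) (half-positive 0<ε) | z→0 (½ * ε) (half-positive 0<ε)
  ... | M , h | N , h′ = M ℕ.⊔ N , λ n le → begin-strict
    ∣ y n + z n ∣         ≤⟨ ℚ.∣p+q∣≤∣p∣+∣q∣ (y n) (z n) ⟩
    ∣ y n ∣ + ∣ z n ∣     <⟨ ℚ.+-mono-< (h n (ℕ.m⊔n≤o⇒m≤o M N le)) (h′ n (ℕ.m⊔n≤o⇒n≤o M N le)) ⟩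
    ½ * ε + ½ * ε         ≡⟨ two-halves ε ⟩
    ε                     ∎
    where open ℚ.≤-Reasoning

  null-neg : ∀ {z} → Null z → Null (λ n → ℚ.- z n)
  null-neg {z} z→0 ε 0<ε with z→0 ε 0<ε
  ... | N , h = N , λ n le → ≡.subst (_< ε) (≡.sym (ℚ.∣-p∣≡∣p∣ (z n))) (h n le)

  eventually-bounded : ∀ x → ∃ λ B → 0ℚ < B × ∃ λ N → ∀ n → N ℕ.≤ n → ∣ seq x n ∣ ≤ B
  eventually-bounded x with cauchy x 1ℚ (ℚ.positive⁻¹ 1ℚ)
  ... | N , h = 1ℚ + ∣ seq x N ∣ , ℚ.+-mono-<-≤ (ℚ.positive⁻¹ 1ℚ) (ℚ.0≤∣p∣ (seq x N)) , N , λ n le → begin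
    ∣ seq x n ∣                           ≤⟨ ∣p∣≤∣p-q∣+∣q∣ (seq x n) (seq x N) ⟩
    ∣ seq x n - seq x N ∣ + ∣ seq x N ∣   ≤⟨ ℚ.+-monoˡ-≤ ∣ seq x N ∣ (ℚ.<⇒≤ (h n N le ℕ.≤-refl)) ⟩
    1ℚ + ∣ seq x N ∣                      ∎
    where open ℚ.≤-Reasoning

  null-* : ∀ {z} x → Null z → Null (λ n → z n * seq x n)
  null-* {z} x z→0 ε 0<ε =
    let B , 0<B , M , b = eventually-bounded x
        C , 0<C , CB≡1  = recip 0<B
        N , h           = z→0 (ε * C) (*-pos 0<ε 0<C)
        εCB≡ε           = ≡.trans (ℚ.*-assoc ε C B) (≡.trans (≡.cong (ε *_) CB≡1) (ℚ.*-identityʳ ε))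
    in M ℕ.⊔ N , λ n le → ≡.subst (∣ z n * seq x n ∣ <_) εCB≡ε
         (∣p*q∣< (z n) (seq x n) 0<B (h n (ℕ.m⊔n≤o⇒n≤o M N le)) (b n (ℕ.m⊔n≤o⇒m≤o M N le)))

  ≡⇒≈ℝ : ∀ x y → (∀ n → seq x n ≡ seq y n) → x ≈ℝ y
  ≡⇒≈ℝ x y x≡y ε 0<ε = 0 , λ n _ → ≡.subst (λ q → ∣ q ∣ < ε)
    (≡.sym (≡.trans (≡.cong (_- seq y n) (x≡y n)) (ℚ.+-inverseʳ (seq y n)))) 0<ε

  ≈ℝ-sym : ∀ x y → x ≈ℝ y → y ≈ℝ x
  ≈ℝ-sym x y x≈y = null-cong (λ n → solve 2 (λ a b → :- (a :- b) := b :- a) ≡.refl (seq x n) (seq y n))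
    (null-neg x≈y)
    where open +-*-Solver

  ≈ℝ-trans : ∀ x y z → x ≈ℝ y → y ≈ℝ z → x ≈ℝ z
  ≈ℝ-trans x y z x≈y y≈z = null-cong
    (λ n → solve 3 (λ a b c → (a :- b) :+ (b :- c) := a :- c) ≡.refl (seq x n) (seq y n) (seq z n))
    (null-+ x≈y y≈z)
    where open +-*-Solver

  +ℝ-cong : ∀ x x′ y y′ → x ≈ℝ x′ → y ≈ℝ y′ → x +ℝ y ≈ℝ x′ +ℝ y′
  +ℝ-cong x x′ y y′ x≈ y≈ = null-cong
    (λ n → solve 4 (λ a b c d → (a :- b) :+ (c :- d) := (a :+ c) :- (b :+ d)) ≡.refl
      (seq x n) (seq x′ n) (seq y n) (seq y′ n))
    (null-+ x≈ y≈)
    where open +-*-Solver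

  *ℝ-cong : ∀ x x′ y y′ → x ≈ℝ x′ → y ≈ℝ y′ → x *ℝ y ≈ℝ x′ *ℝ y′
  *ℝ-cong x x′ y y′ x≈ y≈ = null-cong
    (λ n → solve 4 (λ a b c d → (a :- b) :* c :+ (c :- d) :* b := a :* c :- b :* d) ≡.refl
      (seq x n) (seq x′ n) (seq y n) (seq y′ n))
    (null-+ (null-* y x≈) (null-* x′ y≈))
    where open +-*-Solver

  -ℝ-cong : ∀ x x′ → x ≈ℝ x′ → -ℝ x ≈ℝ -ℝ x′
  -ℝ-cong x x′ x≈ = null-cong
    (λ n → solve 2 (λ a b → :- (a :- b) := :- a :- :- b) ≡.refl (seq x n) (seq x′ n)) (null-neg x≈)
    where open +-*-Solver

  Apart : ℝ → Set
  Apart x = ∃ λ δ → 0ℚ < δ × ∃ λ N → ∀ n → N ℕ.≤ n → δ ≤ ∣ seq x n ∣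

  -- Although x = 0 is undecidable, this alternative is decided by one rational comparison: beyond N
  -- the terms move by less than ε / 4, so whether the N-th term is below ε / 2 determines which
  -- side holds, with gap ε / 4 in the second case.
  small-or-apart : ∀ x ε → 0ℚ < ε → (∃ λ N → ∀ n → N ℕ.≤ n → ∣ seq x n ∣ < ε) ⊎ Apart x
  small-or-apart x ε 0<ε = decide (∣ seq x N ∣ ℚ.<? ½ * ε)
    where
    δ = ½ * (½ * ε)
    0<δ : 0ℚ < δ
    0<δ = half-positive (half-positive 0<ε)
    N = proj₁ (cauchy x δ 0<δ)
    close = proj₂ (cauchy x δ 0<δ)
    open ℚ.≤-Reasoning
    decide : Dec (∣ seq x N ∣ < ½ * ε) → (∃ λ N → ∀ n → N ℕ.≤ n → ∣ seq x n ∣ < ε) ⊎ Apart x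
    decide (yes small) = inj₁ (N , λ n N≤n → begin-strict
      ∣ seq x n ∣                            ≤⟨ ∣p∣≤∣p-q∣+∣q∣ (seq x n) (seq x N) ⟩
      ∣ seq x n - seq x N ∣ + ∣ seq x N ∣    <⟨ ℚ.+-mono-< (close n N N≤n ℕ.≤-refl) small ⟩
      δ + ½ * ε                              ≤⟨ ℚ.+-monoˡ-≤ (½ * ε) δ≤½ε ⟩
      ½ * ε + ½ * ε                          ≡⟨ two-halves ε ⟩
      ε                                      ∎)
      where
      δ≤½ε : δ ≤ ½ * ε
      δ≤½ε = begin
        δ          ≡⟨ ℚ.+-identityʳ δ ⟨
        δ + 0ℚ     ≤⟨ ℚ.+-monoʳ-≤ δ (ℚ.<⇒≤ 0<δ) ⟩
        δ + δ      ≡⟨ two-halves (½ * ε) ⟩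
        ½ * ε      ∎
    decide (no large) = inj₂ (δ , 0<δ , N , λ n N≤n → ℚ.≮⇒≥ λ xₙ<δ → large (begin-strict
      ∣ seq x N ∣                            ≤⟨ ∣p∣≤∣p-q∣+∣q∣ (seq x N) (seq x n) ⟩
      ∣ seq x N - seq x n ∣ + ∣ seq x n ∣    <⟨ ℚ.+-mono-< (close N n ℕ.≤-refl N≤n) xₙ<δ ⟩
      δ + δ                                  ≡⟨ two-halves (½ * ε) ⟩
      ½ * ε                                  ∎))

  apart⇒≉0 : ∀ x → Apart x → ¬ Null (seq x)
  apart⇒≉0 x (δ , 0<δ , M , h) x→0 =
    let N , h′ = x→0 δ 0<δ in <⇒≱ (h′ (M ℕ.⊔ N) (ℕ.m≤n⊔m M N)) (h (M ℕ.⊔ N) (ℕ.m≤m⊔n M N))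

  -- Each ε can be treated separately; apartness of the difference from zero would refute the
  -- equality and is excluded by the hypothesis.
  ≈ℝ-stable : ∀ x y → ¬ ¬ (x ≈ℝ y) → x ≈ℝ y
  ≈ℝ-stable x y ¬¬x≈y ε 0<ε =
    [ id , (λ apart → contradiction (apart⇒≉0 (x -ℝ y) apart) ¬¬x≈y) ] (small-or-apart (x -ℝ y) ε 0<ε)

  ≉0⇒¬¬apart : ∀ x → ¬ Null (seq x) → ¬ ¬ Apart x
  ≉0⇒¬¬apart x x≉0 ¬apart = x≉0 λ ε 0<ε → [ id , (λ a → contradiction a ¬apart) ] (small-or-apart x ε 0<ε)

  inverse-cauchy : ∀ x → Apart x → IsCauchy (inv ∘ seq x)
  inverse-cauchy x (δ , 0<δ , N , h) ε 0<ε =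
    -- The difference of the inverses is (xₙ - xₘ) / (xₘ xₙ), and the denominator is at least δ² in
    -- absolute value; this explains the tolerance ε δ².
    let M , close = cauchy x (ε * (δ * δ)) (*-pos 0<ε (*-pos 0<δ 0<δ))
    in M ℕ.⊔ N , λ m n le-m le-n →
      let M≤m = ℕ.m⊔n≤o⇒m≤o M N le-m
          N≤m = ℕ.m⊔n≤o⇒n≤o M N le-m
          M≤n = ℕ.m⊔n≤o⇒m≤o M N le-n
          N≤n = ℕ.m⊔n≤o⇒n≤o M N le-n
      in ≡.subst₂ _<_
        (≡.cong ∣_∣ (≡.sym (inv-difference (seq x m) (seq x n) (x≢0 m N≤m) (x≢0 n N≤n))))
        cancel
        (∣p*q∣< (seq x n - seq x m) (inv (seq x m) * inv (seq x n)) (*-pos 0<C 0<C)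
          (close n m M≤n M≤m) (inv² m n N≤m N≤n))
    where
    C    = proj₁ (recip 0<δ)
    0<C  = proj₁ (proj₂ (recip 0<δ))
    Cδ≡1 = proj₂ (proj₂ (recip 0<δ))
    x≢0 : ∀ n → N ℕ.≤ n → seq x n ≢ 0ℚ
    x≢0 n N≤n = away-from-zero 0<δ (h n N≤n)
    ∣inv∣≤C : ∀ n → N ℕ.≤ n → ∣ inv (seq x n) ∣ ≤ C
    ∣inv∣≤C n N≤n = inv-bound 0<δ Cδ≡1 0<C (h n N≤n)
    inv² : ∀ m n → N ℕ.≤ m → N ℕ.≤ n → ∣ inv (seq x m) * inv (seq x n) ∣ ≤ C * C
    inv² m n N≤m N≤n = begin
      ∣ inv (seq x m) * inv (seq x n) ∣         ≡⟨ ℚ.∣p*q∣≡∣p∣*∣q∣ (inv (seq x m)) (inv (seq x n)) ⟩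
      ∣ inv (seq x m) ∣ * ∣ inv (seq x n) ∣     ≤⟨ ℚ.*-monoʳ-≤-nonNeg ∣ inv (seq x n) ∣
                                                     {{ℚ.∣-∣-nonNeg (inv (seq x n))}} (∣inv∣≤C m N≤m) ⟩
      C * ∣ inv (seq x n) ∣                     ≤⟨ ℚ.*-monoˡ-≤-nonNeg C
                                                     {{ℚ.pos⇒nonNeg C {{ℚ.positive 0<C}}}} (∣inv∣≤C n N≤n) ⟩
      C * C                                     ∎
      where open ℚ.≤-Reasoning
    cancel : ε * (δ * δ) * (C * C) ≡ ε
    cancel = ≡.trans (regroup ε δ C) (≡.trans (≡.cong (λ q → ε * (q * q)) Cδ≡1) (ℚ.*-identityʳ ε))
      where
      open +-*-Solver
      regroup : ∀ e d c → e * (d * d) * (c * c) ≡ e * ((c * d) * (c * d))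
      regroup = solve 3 (λ e d c → e :* (d :* d) :* (c :* c) := e :* ((c :* d) :* (c :* d))) ≡.refl

  real-inverse : ∀ x → Apart x → ∃ λ y → x *ℝ y ≈ℝ fromℚ 1ℚ
  real-inverse x apart@(δ , 0<δ , N , h) = mkℝ (inv ∘ seq x) (inverse-cauchy x apart) , λ ε 0<ε →
    N , λ n N≤n → ≡.subst (λ q → ∣ q - 1ℚ ∣ < ε)
      (≡.sym (inv-inverse (seq x n) (away-from-zero 0<δ (h n N≤n)))) 0<ε

  -- As x² ≤ x² + y², the hypothesis is tested at ε².
  norm-null : ∀ x y → Null (λ n → seq x n * seq x n + seq y n * seq y n) → Null (seq x)
  norm-null x y ρ→0 ε 0<ε =
    let N , h = ρ→0 (ε * ε) (*-pos 0<ε 0<ε)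
    in N , λ n N≤n → ℚ.≰⇒> λ ε≤∣x∣ → ℚ.<-irrefl ≡.refl (begin-strict
      ε * ε                                    ≤⟨ ℚ.*-monoˡ-≤-nonNeg ε {{ℚ.pos⇒nonNeg ε {{ℚ.positive 0<ε}}}} ε≤∣x∣ ⟩
      ε * ∣ seq x n ∣                          ≤⟨ ℚ.*-monoʳ-≤-nonNeg ∣ seq x n ∣ {{ℚ.∣-∣-nonNeg (seq x n)}} ε≤∣x∣ ⟩
      ∣ seq x n ∣ * ∣ seq x n ∣                ≡⟨ ℚ.∣p*q∣≡∣p∣*∣q∣ (seq x n) (seq x n) ⟨
      ∣ seq x n * seq x n ∣                    ≡⟨ ℚ.0≤p⇒∣p∣≡p (square-nonNeg (seq x n)) ⟩
      seq x n * seq x n                        ≡⟨ ℚ.+-identityʳ _ ⟨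
      seq x n * seq x n + 0ℚ                   ≤⟨ ℚ.+-monoʳ-≤ (seq x n * seq x n) (square-nonNeg (seq y n)) ⟩
      seq x n * seq x n + seq y n * seq y n    ≤⟨ p≤∣p∣ _ ⟩
      ∣ seq x n * seq x n + seq y n * seq y n ∣ <⟨ h n N≤n ⟩
      ε * ε                                    ∎)
    where open ℚ.≤-Reasoning

-- The complex numbers as a weak field

module ComplexField where

  open import Data.Rational.Base using (_<_; _≤_; _+_; _*_; _-_; -_; ∣_∣)
  open RationalLemmas
  open RealNumbers
  private module ℂᵣ = RawRing ℂ-rawRing

  -- The ring laws of ℂ already hold term by term between representing sequences and thus reduce to
  -- identities over ℚ.
  ≡⇒≈ : ∀ {z w} → (∀ n → seq (re z) n ≡ seq (re w) n) → (∀ n → seq (im z) n ≡ seq (im w) n) → z ℂᵣ.≈ w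
  ≡⇒≈ {z} {w} p q = ≡⇒≈ℝ (re z) (re w) p , ≡⇒≈ℝ (im z) (im w) q

  abstract
    *-assoc-re : ∀ a b c d e f →
      (a * c - b * d) * e - (a * d + b * c) * f ≡ a * (c * e - d * f) - b * (c * f + d * e)
    *-assoc-re = solve 6 (λ a b c d e f →
      (a :* c :- b :* d) :* e :- (a :* d :+ b :* c) :* f := a :* (c :* e :- d :* f) :- b :* (c :* f :+ d :* e)) ≡.refl
      where open +-*-Solver

    *-assoc-im : ∀ a b c d e f →
      (a * c - b * d) * f + (a * d + b * c) * e ≡ a * (c * f + d * e) + b * (c * e - d * f)
    *-assoc-im = solve 6 (λ a b c d e f →
      (a :* c :- b :* d) :* f :+ (a :* d :+ b :* c) :* e := a :* (c :* f :+ d :* e) :+ b :* (c :* e :- d :* f)) ≡.refl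
      where open +-*-Solver

    *-comm-re : ∀ a b c d → a * c - b * d ≡ c * a - d * b
    *-comm-re = solve 4 (λ a b c d → a :* c :- b :* d := c :* a :- d :* b) ≡.refl
      where open +-*-Solver

    *-comm-im : ∀ a b c d → a * d + b * c ≡ c * b + d * a
    *-comm-im = solve 4 (λ a b c d → a :* d :+ b :* c := c :* b :+ d :* a) ≡.refl
      where open +-*-Solver

    distribʳ-re : ∀ a b c d e f → (c + e) * a - (d + f) * b ≡ (c * a - d * b) + (e * a - f * b)
    distribʳ-re = solve 6 (λ a b c d e f →
      (c :+ e) :* a :- (d :+ f) :* b := (c :* a :- d :* b) :+ (e :* a :- f :* b)) ≡.refl
      where open +-*-Solver

    distribʳ-im : ∀ a b c d e f → (c + e) * b + (d + f) * a ≡ (c * b + d * a) + (e * b + f * a)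
    distribʳ-im = solve 6 (λ a b c d e f →
      (c :+ e) :* b :+ (d :+ f) :* a := (c :* b :+ d :* a) :+ (e :* b :+ f :* a)) ≡.refl
      where open +-*-Solver

    identityˡ-re : ∀ a b → 1ℚ * a - 0ℚ * b ≡ a
    identityˡ-re = solve 2 (λ a b → con 1ℚ :* a :- con 0ℚ :* b := a) ≡.refl
      where open +-*-Solver

    identityˡ-im : ∀ a b → 1ℚ * b + 0ℚ * a ≡ b
    identityˡ-im = solve 2 (λ a b → con 1ℚ :* b :+ con 0ℚ :* a := b) ≡.refl
      where open +-*-Solver

    conjugate-re : ∀ a b u → a * (a * u) - b * (- (b * u)) ≡ (a * a + b * b) * u
    conjugate-re = solve 3 (λ a b u → a :* (a :* u) :- b :* (:- (b :* u)) := (a :* a :+ b :* b) :* u) ≡.refl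
      where open +-*-Solver

    conjugate-im : ∀ a b u → a * (- (b * u)) + b * (a * u) ≡ 0ℚ
    conjugate-im = solve 3 (λ a b u → a :* (:- (b :* u)) :+ b :* (a :* u) := con 0ℚ) ≡.refl
      where open +-*-Solver

  ≈-sym : ∀ {z w} → z ℂᵣ.≈ w → w ℂᵣ.≈ z
  ≈-sym {z} {w} (p , q) = ≈ℝ-sym (re z) (re w) p , ≈ℝ-sym (im z) (im w) q

  ≈-trans : ∀ {u v w} → u ℂᵣ.≈ v → v ℂᵣ.≈ w → u ℂᵣ.≈ w
  ≈-trans {u} {v} {w} (p , q) (p′ , q′) =
    ≈ℝ-trans (re u) (re v) (re w) p p′ , ≈ℝ-trans (im u) (im v) (im w) q q′

  ≈-refl : ∀ {z} → z ℂᵣ.≈ z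
  ≈-refl {z} = ≡⇒≈ {z} {z} (λ _ → ≡.refl) (λ _ → ≡.refl)

  +-cong : ∀ {z z′ w w′} → z ℂᵣ.≈ z′ → w ℂᵣ.≈ w′ → (z ℂᵣ.+ w) ℂᵣ.≈ (z′ ℂᵣ.+ w′)
  +-cong {z} {z′} {w} {w′} (p , q) (p′ , q′) =
    +ℝ-cong (re z) (re z′) (re w) (re w′) p p′ , +ℝ-cong (im z) (im z′) (im w) (im w′) q q′

  -‿cong : ∀ {z w} → z ℂᵣ.≈ w → (ℂᵣ.- z) ℂᵣ.≈ (ℂᵣ.- w)
  -‿cong {z} {w} (p , q) = -ℝ-cong (re z) (re w) p , -ℝ-cong (im z) (im w) q

  *-cong : ∀ {z z′ w w′} → z ℂᵣ.≈ z′ → w ℂᵣ.≈ w′ → (z ℂᵣ.* w) ℂᵣ.≈ (z′ ℂᵣ.* w′)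
  *-cong {z} {z′} {w} {w′} (p , q) (p′ , q′) =
      +ℝ-cong (re z *ℝ re w) (re z′ *ℝ re w′) (-ℝ (im z *ℝ im w)) (-ℝ (im z′ *ℝ im w′))
        (*ℝ-cong (re z) (re z′) (re w) (re w′) p p′)
        (-ℝ-cong (im z *ℝ im w) (im z′ *ℝ im w′) (*ℝ-cong (im z) (im z′) (im w) (im w′) q q′))
    , +ℝ-cong (re z *ℝ im w) (re z′ *ℝ im w′) (im z *ℝ re w) (im z′ *ℝ re w′)
        (*ℝ-cong (re z) (re z′) (im w) (im w′) p q′)
        (*ℝ-cong (im z) (im z′) (re w) (re w′) q p′)

  private
    ℂ-setoid : Setoid 0ℓ 0ℓ
    ℂ-setoid = record
      { Carrier = ℂ ; _≈_ = ℂᵣ._≈_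
      ; isEquivalence = record
        { refl  = λ {z} → ≈-refl {z}
        ; sym   = λ {z} {w} → ≈-sym {z} {w}
        ; trans = λ {u} {v} {w} → ≈-trans {u} {v} {w} } }

    open Consequences ℂ-setoid

    +-comm : ∀ z w → (z ℂᵣ.+ w) ℂᵣ.≈ (w ℂᵣ.+ z)
    +-comm z w = ≡⇒≈ {z ℂᵣ.+ w} {w ℂᵣ.+ z} (λ n → ℚ.+-comm (seq (re z) n) (seq (re w) n)) (λ n → ℚ.+-comm (seq (im z) n) (seq (im w) n))

    *-comm : ∀ z w → (z ℂᵣ.* w) ℂᵣ.≈ (w ℂᵣ.* z)
    *-comm z w = ≡⇒≈ {z ℂᵣ.* w} {w ℂᵣ.* z}
      (λ n → *-comm-re (seq (re z) n) (seq (im z) n) (seq (re w) n) (seq (im w) n))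
      (λ n → *-comm-im (seq (re z) n) (seq (im z) n) (seq (re w) n) (seq (im w) n))

    *-assoc : ∀ u z w → ((u ℂᵣ.* z) ℂᵣ.* w) ℂᵣ.≈ (u ℂᵣ.* (z ℂᵣ.* w))
    *-assoc u z w = ≡⇒≈ {(u ℂᵣ.* z) ℂᵣ.* w} {u ℂᵣ.* (z ℂᵣ.* w)}
      (λ n → *-assoc-re (seq (re u) n) (seq (im u) n) (seq (re z) n) (seq (im z) n) (seq (re w) n) (seq (im w) n))
      (λ n → *-assoc-im (seq (re u) n) (seq (im u) n) (seq (re z) n) (seq (im z) n) (seq (re w) n) (seq (im w) n))

    *-identityˡ : ∀ z → (ℂᵣ.1# ℂᵣ.* z) ℂᵣ.≈ z
    *-identityˡ z = ≡⇒≈ {ℂᵣ.1# ℂᵣ.* z} {z}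
      (λ n → identityˡ-re (seq (re z) n) (seq (im z) n)) (λ n → identityˡ-im (seq (re z) n) (seq (im z) n))

    distribʳ : ∀ u z w → ((z ℂᵣ.+ w) ℂᵣ.* u) ℂᵣ.≈ ((z ℂᵣ.* u) ℂᵣ.+ (w ℂᵣ.* u))
    distribʳ u z w = ≡⇒≈ {(z ℂᵣ.+ w) ℂᵣ.* u} {(z ℂᵣ.* u) ℂᵣ.+ (w ℂᵣ.* u)}
      (λ n → distribʳ-re (seq (re u) n) (seq (im u) n) (seq (re z) n) (seq (im z) n) (seq (re w) n) (seq (im w) n))
      (λ n → distribʳ-im (seq (re u) n) (seq (im u) n) (seq (re z) n) (seq (im z) n) (seq (re w) n) (seq (im w) n))

  ℂ-commutativeRing : CommutativeRing 0ℓ 0ℓ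
  ℂ-commutativeRing = record
    { Carrier = ℂ ; _≈_ = ℂᵣ._≈_ ; _+_ = ℂᵣ._+_ ; _*_ = ℂᵣ._*_ ; -_ = λ z → ℂᵣ.- z ; 0# = ℂᵣ.0# ; 1# = ℂᵣ.1#
    ; isCommutativeRing = record
      { isRing = record
        { +-isAbelianGroup = record
          { isGroup = record
            { isMonoid = record
              { isSemigroup = record
                { isMagma = record
                  { isEquivalence = Setoid.isEquivalence ℂ-setoid
                  ; ∙-cong = λ {z} {z′} {w} {w′} → +-cong {z} {z′} {w} {w′} }
                ; assoc = λ u z w → ≡⇒≈ {(u ℂᵣ.+ z) ℂᵣ.+ w} {u ℂᵣ.+ (z ℂᵣ.+ w)}
                    (λ n → ℚ.+-assoc (seq (re u) n) (seq (re z) n) (seq (re w) n))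
                    (λ n → ℚ.+-assoc (seq (im u) n) (seq (im z) n) (seq (im w) n)) }
              ; identity = comm∧idˡ⇒id {_∙_ = ℂᵣ._+_} +-comm {ℂᵣ.0#} (λ z → ≡⇒≈ {ℂᵣ.0# ℂᵣ.+ z} {z}
                  (λ n → ℚ.+-identityˡ _) (λ n → ℚ.+-identityˡ _)) }
            ; inverse = comm∧invˡ⇒inv {_∙_ = ℂᵣ._+_} {λ z → ℂᵣ.- z} {ℂᵣ.0#} +-comm
                (λ z → ≡⇒≈ {(ℂᵣ.- z) ℂᵣ.+ z} {ℂᵣ.0#} (λ n → ℚ.+-inverseˡ (seq (re z) n)) (λ n → ℚ.+-inverseˡ (seq (im z) n)))
            ; ⁻¹-cong = λ {z} {w} → -‿cong {z} {w} }
          ; comm = +-comm }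
        ; *-cong = λ {z} {z′} {w} {w′} → *-cong {z} {z′} {w} {w′}
        ; *-assoc = *-assoc
        ; *-identity = comm∧idˡ⇒id {_∙_ = ℂᵣ._*_} *-comm {ℂᵣ.1#} *-identityˡ
        ; distrib = comm∧distrʳ⇒distr {_∙_ = ℂᵣ._*_} {_◦_ = ℂᵣ._+_}
            (λ {z} {z′} {w} {w′} → +-cong {z} {z′} {w} {w′}) *-comm distribʳ }
      ; *-comm = *-comm } }

  open Mult (CommutativeRing.+-monoid ℂ-commutativeRing) using () renaming (_×_ to _×ₘ_)

  null⇒≈0 : ∀ x → Null (seq x) → x ≈ℝ fromℚ 0ℚ
  null⇒≈0 x = null-cong (λ n → ≡.sym (ℚ.+-identityʳ (seq x n)))

  norm² : ℂ → ℝ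
  norm² z = re z *ℝ re z +ℝ im z *ℝ im z

  norm²-null : ∀ z → Null (seq (norm² z)) → z ℂᵣ.≈ ℂᵣ.0#
  norm²-null z h = null⇒≈0 (re z) (norm-null (re z) (im z) h)
    , null⇒≈0 (im z) (norm-null (im z) (re z) (null-cong
        (λ n → ℚ.+-comm (seq (re z) n * seq (re z) n) (seq (im z) n * seq (im z) n)) h))

  complex-inverse : ∀ z → Apart (norm² z) → ∃ λ w → (z ℂᵣ.* w) ℂᵣ.≈ ℂᵣ.1#
  complex-inverse z apart =
    let u , ρu≈1 = real-inverse (norm² z) apart
        -- The conjugate of z divided by its squared modulus.
        w        = (re z *ℝ u) +i (-ℝ (im z *ℝ u))
    in w , (≈ℝ-trans (re (z ℂᵣ.* w)) (norm² z *ℝ u) (fromℚ 1ℚ)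
             (≡⇒≈ℝ (re (z ℂᵣ.* w)) (norm² z *ℝ u) λ n → conjugate-re (seq (re z) n) (seq (im z) n) (seq u n))
             ρu≈1)
         , ≡⇒≈ℝ (im (z ℂᵣ.* w)) (fromℚ 0ℚ) λ n → conjugate-im (seq (re z) n) (seq (im z) n) (seq u n)

  re-multiple-nonNeg : ∀ n k → 0ℚ ≤ seq (re (n ×ₘ ℂᵣ.1#)) k
  re-multiple-nonNeg zero    k = ℚ.≤-refl
  re-multiple-nonNeg (suc n) k = ℚ.+-mono-≤ (ℚ.<⇒≤ (ℚ.positive⁻¹ 1ℚ)) (re-multiple-nonNeg n k)

  -- Every term of the real part is at least 1, hence never within distance 1 of zero.
  multiple≉0 : ∀ n → ¬ ((suc n ×ₘ ℂᵣ.1#) ℂᵣ.≈ ℂᵣ.0#)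
  multiple≉0 n (re≈0 , _) =
    let N , h = re≈0 1ℚ (ℚ.positive⁻¹ 1ℚ)
        s     = seq (re (n ×ₘ ℂᵣ.1#)) N
    in <⇒≱ (h N ℕ.≤-refl) (begin
      1ℚ                     ≡⟨ ℚ.+-identityʳ 1ℚ ⟨
      1ℚ + 0ℚ                ≤⟨ ℚ.+-monoʳ-≤ 1ℚ (re-multiple-nonNeg n N) ⟩
      1ℚ + s                 ≡⟨ ℚ.+-identityʳ (1ℚ + s) ⟨
      1ℚ + s - 0ℚ            ≤⟨ p≤∣p∣ (1ℚ + s - 0ℚ) ⟩
      ∣ 1ℚ + s - 0ℚ ∣        ∎)
    where open ℚ.≤-Reasoning

  ℂ-isWeakField : IsWeakField ℂ-commutativeRing
  ℂ-isWeakField = record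
    { stable  = λ {z} {w} ¬¬z≈w → ≈ℝ-stable (re z) (re w) (λ k → ¬¬z≈w (k ∘ proj₁))
                                , ≈ℝ-stable (im z) (im w) (λ k → ¬¬z≈w (k ∘ proj₂))
    ; inverse = λ {z} z≉0 → ≉0⇒¬¬apart (norm² z) (z≉0 ∘ norm²-null z) >>= λ apart →
                return (complex-inverse z apart)
    ; char0   = multiple≉0 }

-- The cubic bound

minimum-≤ : ∀ {n} (k : Vector ℕ (suc n)) i → minimum k ℕ.≤ k i
minimum-≤ {n} k = λ where
    zero    → head (Vector.tail k)
    (suc i) → tail (Vector.tail k) i
  where
  fold : ∀ {n} → Vector ℕ n → ℕ
  fold = Vector.foldr ℕ._⊓_ (k zero)
  head : ∀ {n} (t : Vector ℕ n) → fold t ℕ.≤ k zero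
  head {zero}  t = ℕ.≤-refl
  head {suc n} t = ℕ.≤-trans (ℕ.m⊓n≤n (t zero) _) (head (t ∘ suc))
  tail : ∀ {n} (t : Vector ℕ n) i → fold t ℕ.≤ t i
  tail t zero    = ℕ.m⊓n≤m (t zero) _
  tail t (suc i) = ℕ.≤-trans (ℕ.m⊓n≤n (t zero) _) (tail (t ∘ suc) i)

cubic : ℕ → ℤ
cubic m = (+ m) ℤ.^ 3 ℤ.+ + 7 ℤ.* (+ m) ℤ.^ 2 ℤ.- + 49 ℤ.* + m ℤ.+ + 68

-- The difference of the two sides is r³ + 13 r² + 8 r + 2.
cubic-dominates : ∀ r → + (3 ℕ.* ((3 ℕ.+ r) ℕ.* suc r)) ℤ.< cubic (3 ℕ.+ r)
cubic-dominates r = ≡.subst (+ quadratic ℤ.<_) (≡.sym identity)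
  (ℤ.+<+ (ℕ.m<m+n quadratic {positive-part} (ℕ.s≤s ℕ.z≤n)))
  where
  quadratic positive-part : ℕ
  quadratic     = 3 ℕ.* ((3 ℕ.+ r) ℕ.* suc r)
  positive-part = 2 ℕ.+ (r ℕ.* r ℕ.* r ℕ.+ 13 ℕ.* (r ℕ.* r) ℕ.+ 8 ℕ.* r)
  identity : cubic (3 ℕ.+ r) ≡ + (quadratic ℕ.+ positive-part)
  identity = ≡.trans (over-ℤ (+ r)) (≡.sym pushed)
    where
    over-ℤ : ∀ x → (+ 3 ℤ.+ x) ℤ.^ 3 ℤ.+ + 7 ℤ.* (+ 3 ℤ.+ x) ℤ.^ 2 ℤ.- + 49 ℤ.* (+ 3 ℤ.+ x) ℤ.+ + 68
      ≡ + 3 ℤ.* ((+ 3 ℤ.+ x) ℤ.* (+ 1 ℤ.+ x)) ℤ.+ (+ 2 ℤ.+ (x ℤ.* x ℤ.* x ℤ.+ + 13 ℤ.* (x ℤ.* x) ℤ.+ + 8 ℤ.* x))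
    over-ℤ = solve 1 (λ x →
      (con (+ 3) :+ x) :^ 3 :+ con (+ 7) :* (con (+ 3) :+ x) :^ 2 :- con (+ 49) :* (con (+ 3) :+ x) :+ con (+ 68)
      := con (+ 3) :* ((con (+ 3) :+ x) :* (con (+ 1) :+ x)) :+ (con (+ 2) :+ (x :* x :* x :+ con (+ 13) :* (x :* x) :+ con (+ 8) :* x)))
      ≡.refl
      where open ℤSolver.+-*-Solver
    pushed : + (quadratic ℕ.+ positive-part) ≡
      + 3 ℤ.* ((+ 3 ℤ.+ + r) ℤ.* (+ 1 ℤ.+ + r)) ℤ.+ (+ 2 ℤ.+ (+ r ℤ.* + r ℤ.* + r ℤ.+ + 13 ℤ.* (+ r ℤ.* + r) ℤ.+ + 8 ℤ.* + r))
    pushed = ≡.cong₂ ℤ._+_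
      (≡.trans (ℤ.pos-* 3 ((3 ℕ.+ r) ℕ.* suc r)) (≡.cong (+ 3 ℤ.*_) (ℤ.pos-* (3 ℕ.+ r) (suc r))))
      (≡.cong (ℤ._+_ (+ 2)) (≡.cong₂ ℤ._+_
        (≡.cong₂ ℤ._+_ (≡.trans (ℤ.pos-* (r ℕ.* r) r) (≡.cong (ℤ._* + r) (ℤ.pos-* r r)))
          (≡.trans (ℤ.pos-* 13 (r ℕ.* r)) (≡.cong (+ 13 ℤ.*_) (ℤ.pos-* r r))))
        (ℤ.pos-* 8 r)))

-- Among unnormalised fractions the order is cross-multiplication, which is the hypothesis itself;
-- no common factors have to be cancelled.
third-< : ∀ k (z : ℤ) → + (3 ℕ.* k) ℤ.< z → (+ k) / 1 ℚ.< (+ 1 / 3) ℚ.* (z / 1)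
third-< k z 3k<z = ℚ.toℚᵘ-cancel-< (begin-strict
    ℚ.toℚᵘ ((+ k) / 1)                          ≃⟨ ℚ.toℚᵘ-fromℚᵘ ((+ k) ℚᵘ./ 1) ⟩
    (+ k) ℚᵘ./ 1                                <⟨ ℚᵘ.*<* core ⟩
    (+ 1 ℚᵘ./ 3) ℚᵘ.* (z ℚᵘ./ 1)                ≃⟨ ℚᵘ.*-cong (ℚ.toℚᵘ-fromℚᵘ (+ 1 ℚᵘ./ 3)) (ℚ.toℚᵘ-fromℚᵘ (z ℚᵘ./ 1)) ⟨
    ℚ.toℚᵘ (+ 1 / 3) ℚᵘ.* ℚ.toℚᵘ (z / 1)        ≃⟨ ℚ.toℚᵘ-homo-* (+ 1 / 3) (z / 1) ⟨
    ℚ.toℚᵘ ((+ 1 / 3) ℚ.* (z / 1))              ∎)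
  where
  open ℚᵘ.≤-Reasoning
  core : + k ℤ.* + 3 ℤ.< (+ 1 ℤ.* z) ℤ.* + 1
  core = ≡.subst₂ ℤ._<_
    (≡.trans (≡.cong +_ (ℕ.*-comm 3 k)) (ℤ.pos-* k 3))
    (≡.sym (≡.trans (ℤ.*-identityʳ _) (ℤ.*-identityˡ z))) 3k<z

theorem2p3 : (n : ℕ) → let m = suc n in 3 ℕ.≤ m →
    (p : Vector ℂ[x].Poly m) → (∀ i → p i ℂ[x].≉ ℂ[x].0#) →
    (k : Vector ℕ m) → (∀ i → 0 ℕ.< k i) →
    ℂ[x].JointlyCoprime (λ i → p i ℂ[x].^ k i) →
    ℂ[x].sum (λ i → p i ℂ[x].^ k i) ℂ[x].≈ ℂ[x].0# →
    (∀ (j : Fin m) → ℂ[x].LinearlyIndependent (removeAt (λ i → p i ℂ[x].^ k i) j)) →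
    (+ minimum k) / 1
    ℚ.< (+ 1 / 3) ℚ.* (((+ m) ℤ.^ 3 ℤ.+ + 7 ℤ.* (+ m) ℤ.^ 2 ℤ.- + 49 ℤ.* + m ℤ.+ + 68) / 1)
theorem2p3 (suc (suc r)) (ℕ.s≤s (ℕ.s≤s (ℕ.s≤s ℕ.z≤n))) p p≉0 k _ coprime Σ≈0 independent =
  third-< (minimum k) (cubic (3 ℕ.+ r)) (ℤ.≤-<-trans
    (ℤ.+≤+ (ℕ.*-monoʳ-≤ 3 minimum-small)) (cubic-dominates r))
  where
  open ComplexField
  minimum-small : minimum k ℕ.≤ (3 ℕ.+ r) ℕ.* suc r
  -- The order of ℕ is decidable, so refuting the reverse inequality suffices; that inequality would
  -- push every exponent above m (m - 2).
  minimum-small = ℕ.≮⇒≥ λ large → FermatEquation.no-large-exponents ℂ-commutativeRing ℂ-isWeakField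
    p p≉0 k coprime Σ≈0 independent λ i → ℕ.<-≤-trans large (minimum-≤ k i)
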